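{- Let $p$ be a prime with $p\neq 3$, and let $C(x,y,z)=ax^3+by^3+cz^3$ with $a,b,c$ integers such that $p\nmid abc$. Then $R(C)$ is dense in $\mathbb{Q}_p$.
   Context: For an integral form $F$ in $r$ variables, $R(F)=\{F(\overline{x})/F(\overline{y}):\overline{x},\overline{y}\in\mathbb{Z}^r,\ F(\overline{y})\neq 0\}$, viewed as a subset of the field $\mathbb{Q}_p$ of $p$-adic numbers with its $p$-adic topology. -}

module Defs where

open import Data.Integer.Base as ℤ using (ℤ; 0ℤ)
open import Data.Integer.GCD using (gcd)
open import Data.Nat.Base as ℕ using (ℕ; zero; suc)
open import Data.Nat.Divisibility using (_∣?_)
open import Data.Nat.Primality using (Prime; prime⇒nonZero)
open import Data.Nat.Properties using (m^n≢0)
open import Data.Product.Base using (Σ-syntax; ∃-syntax; _×_; _,_)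
open import Data.Rational.Base as ℚ
  using (ℚ; 0ℚ; _/_; _÷_; _-_; _<_; NonZero; ≢-nonZero; ↧ₙ_)
open import Data.Rational.Properties using (↥-/; _≟_; p≡0⇒↥p≡0; +-inverseʳ)
open import Data.Vec.Base using (Vec; []; _∷_)
open import Relation.Binary.PropositionalEquality
  using (_≡_; _≢_; refl; sym; trans; cong; subst)
open import Relation.Nullary using (yes; no)

module _ (p : ℕ) (p-prime : Prime p) where

  private instance
    p≢0 : ℕ.NonZero p
    p≢0 = prime⇒nonZero p-prime

  -- The exponent of p in n, counted by at most `fuel` divisions by p.
  ordWithin : (fuel n : ℕ) → ℕ
  ordWithin zero       n = 0
  ordWithin (suc fuel) n with p ∣? n
  ... | yes _ = suc (ordWithin fuel (n ℕ./ p))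
  ... | no  _ = 0

  -- For n ≢ 0 the fuel n suffices, since p ^ n > n.  The value at n = 0 is
  -- junk and is never used below.
  ord : ℕ → ℕ
  ord n = ordWithin n n

  -- |n/d|ₚ = p ^ (ord d − ord n), written as a quotient of natural powers.
  abs : ℚ → ℚ
  abs q with q ≟ 0ℚ
  ... | yes _ = 0ℚ
  ... | no  _ =
    _/_ (ℤ.+ (p ℕ.^ ord (↧ₙ q)))
        (p ℕ.^ ord ℤ.∣ ℚ.↥ q ∣)
        {{m^n≢0 p (ord ℤ.∣ ℚ.↥ q ∣)}}

  -- The p-adic numbers, as the completion of ℚ with respect to abs:
  -- Cauchy sequences of rationals, to be identified along _≈_ below.
  record ℚₚ : Set where
    constructor mkℚₚ
    field
      term   : ℕ → ℚ
      cauchy : ∀ ε → 0ℚ < ε →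
               ∃[ N ] (∀ m n → N ℕ.≤ m → N ℕ.≤ n → abs (term m - term n) < ε)

  open ℚₚ public

  -- |α − β|ₚ < ε.  The sequence |αₙ − βₙ|ₚ is eventually constant unless it
  -- tends to 0, so its limit is < ε exactly when its terms eventually are.
  Within : ℚ → ℚₚ → ℚₚ → Set
  Within ε α β = ∃[ N ] (∀ n → N ℕ.≤ n → abs (term α n - term β n) < ε)

  _≈_ : ℚₚ → ℚₚ → Set
  α ≈ β = ∀ ε → 0ℚ < ε → Within ε α β

  ι : ℚ → ℚₚ
  ι q = mkℚₚ (λ _ → q) λ ε 0<ε → 0 , λ _ _ _ _ →
    subst (λ d → abs d < ε) (sym (+-inverseʳ q)) 0<ε

  -- Density for the p-adic topology, whose basic open sets are the balls
  -- { β : |α − β|ₚ < ε }.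
  Dense : (ℚₚ → Set) → Set
  Dense S = ∀ α ε → 0ℚ < ε → ∃[ β ] (S β × Within ε α β)

/1-nonZero : ∀ {i} → i ≢ 0ℤ → NonZero (i / 1)
/1-nonZero {i} i≢0 = ≢-nonZero λ i/1≡0 → i≢0
  (trans (sym (↥-/ i 1)) (cong (ℤ._* gcd i (ℤ.+ 1)) (p≡0⇒↥p≡0 (i / 1) i/1≡0)))

fraction : (i j : ℤ) → j ≢ 0ℤ → ℚ
fraction i j j≢0 = _÷_ (i / 1) (j / 1) {{/1-nonZero j≢0}}

-- The ratio set of an integral form in r variables, given by its evaluation
-- map, as a subset of ℚₚ.
R : ∀ p (p-prime : Prime p) {r} → (Vec ℤ r → ℤ) → ℚₚ p p-prime → Set
R p p-prime {r} F α =
  ∃[ x ] ∃[ y ] Σ[ Fy≢0 ∈ F y ≢ 0ℤ ]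
    (_≈_ p p-prime α (ι p p-prime (fraction (F x) (F y) Fy≢0)))

diagonalCubic : (a b c : ℤ) → Vec ℤ 3 → ℤ
diagonalCubic a b c (x ∷ y ∷ z ∷ []) =
  a ℤ.* x ℤ.^ 3 ℤ.+ b ℤ.* y ℤ.^ 3 ℤ.+ c ℤ.* z ℤ.^ 3

{-# OPTIONS --safe #-}
module Submission where

-- The cubic C has a zero modulo p with a coordinate prime to p.  As p ≠ 3 this zero is nonsingular,
-- so by Hensel's lemma C takes, modulo every power of p, all values divisible by p.  Hence
-- m/d = pm/pd is approximated by ratios of values of C.
--
-- The zero modulo p is found by contradiction.  If there is none, then aH, bH and cH are disjoint,
-- where H is the group of nonzero cubes; as cubing is at most three-to-one they cover all nonzero
-- residues.  Since C has no zero, t + b lies in aH ∪ bH for t in A = aH ∪ {0}.  Send t to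
-- at/(t + b) in the first case and to ab/(t + b) in the second: this is an injection of A into
-- itself which misses 0, contradicting the finiteness of A.

open import Defs
open import Data.Empty using (⊥; ⊥-elim)
open import Data.Fin.Base as Fin using (Fin; toℕ; fromℕ<; punchOut)
open import Data.Fin.Patterns using (0F; 1F; 2F)
import Data.Fin.Properties as Fin
open import Data.Integer.Base hiding (suc)
open import Data.Integer.DivMod using (n%ℕd<d; a≡a%ℕn+[a/ℕn]*n)
open import Data.Integer.Divisibility using (_∣_)
import Data.Integer.Divisibility.Signed as Signed
open import Data.Integer.Divisibility.Signed using (divides; ∣⇒∣ᵤ; ∣ᵤ⇒∣)
import Data.Integer.Properties as ℤ
open import Data.Integer.Tactic.RingSolver using (solve)
open import Data.List.Base using ([]; _∷_)
open import Data.Nat.Base as ℕ using (ℕ; zero; suc)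
import Data.Nat.DivMod as ℕ
import Data.Nat.Divisibility as ℕ
open import Data.Nat.Primality
  using (Prime; prime?; prime⇒nonZero; prime⇒nonTrivial; prime⇒irreducible; euclidsLemma; ¬prime[1])
import Data.Nat.Properties as ℕ
import Data.Nat.Tactic.RingSolver as ℕSolver
open import Data.Product.Base as Product using (∃-syntax; _×_; _,_; proj₁; proj₂)
open import Data.Rational.Base as ℚ using (ℚ; mkℚ; 0ℚ; ↥_; ↧_; ↧ₙ_; toℚᵘ)
import Data.Rational.Properties as ℚ
import Data.Rational.Unnormalised.Base as ℚᵘ
import Data.Rational.Unnormalised.Properties as ℚᵘ
open import Data.Sum.Base as Sum using (_⊎_; inj₁; inj₂)
open import Data.Unit.Base using (tt)
open import Data.Vec.Base as Vec using (Vec)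
open import Function.Base using (_∘_; case_of_; it)
open import Relation.Binary.Definitions using (tri<; tri≈; tri>)
open import Relation.Binary.PropositionalEquality
  using (_≡_; _≢_; refl; sym; trans; cong; cong₂; subst; subst₂; module ≡-Reasoning)
open import Relation.Nullary using (Dec; yes; no; ¬_)
open import Relation.Nullary.Decidable
  using (map′; toWitness; decidable-stable; _×-dec_; _⊎-dec_; ¬?)

-- Pigeonhole on finite sets, and colouring the orbits of a map of order three.

injection⇒surjection : ∀ {n} (f : Fin n → Fin n) → (∀ i j → f i ≡ f j → i ≡ j) → ∀ k → ∃[ i ] f i ≡ k
injection⇒surjection {suc n} f f-injective k with Fin.any? (λ i → f i Fin.≟ k)
... | yes hit = hit
-- If `k` is missed, deleting it from the codomain injects `suc n` elements into `n`.
... | no miss = ⊥-elim (ℕ.1+n≰n (Fin.injective⇒≤ {f = λ i → punchOut (k≢f i)} punched-injective))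
  where
  k≢f : ∀ i → k ≢ f i
  k≢f i k≡fi = miss (i , sym k≡fi)

  punched-injective : ∀ {i j} → punchOut (k≢f i) ≡ punchOut (k≢f j) → i ≡ j
  punched-injective {i} {j} eq = f-injective i j (Fin.punchOut-injective (k≢f i) (k≢f j) eq)

module Rotation {n} (σ : Fin n → Fin n) (σ³ : ∀ i → σ (σ (σ i)) ≡ i) where

  private
    First : (i j k : Fin n) → Set
    First i j k = i Fin.< j × i Fin.< k

    first? : ∀ i j k → Dec (First i j k)
    first? i j k = (i Fin.<? j) ×-dec (i Fin.<? k)

    colour′ : (i j k : Fin n) → Fin 3
    colour′ i j k with first? i j k | first? j k i
    ... | yes _ | _     = 0F
    ... | no _  | yes _ = 1F
    ... | no _  | no _  = 2F

    some-first : ∀ {i j k} → i ≢ j → j ≢ k → i ≢ k → ¬ First i j k → ¬ First j k i → ¬ First k i j → ⊥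
    some-first {i} {j} {k} i≢j j≢k i≢k ¬i ¬j ¬k with Fin.<-cmp i j | Fin.<-cmp j k | Fin.<-cmp i k
    ... | tri≈ _ e _   | _            | _            = i≢j e
    ... | tri< _ _ _   | tri≈ _ e _   | _            = j≢k e
    ... | tri> _ _ _   | tri≈ _ e _   | _            = j≢k e
    ... | tri< i<j _ _ | _            | tri< i<k _ _ = ¬i (i<j , i<k)
    ... | _            | _            | tri≈ _ e _   = i≢k e
    ... | tri< i<j _ _ | _            | tri> _ _ k<i = ¬k (k<i , Fin.<-trans k<i i<j)
    ... | tri> _ _ j<i | tri< j<k _ _ | _            = ¬j (j<k , j<i)
    ... | tri> _ _ j<i | tri> _ _ k<j | _            = ¬k (Fin.<-trans k<j j<i , k<j)

    colour′-rotates : ∀ {i j k} → i ≢ j → j ≢ k → i ≢ k → colour′ i j k ≢ colour′ j k i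
    colour′-rotates {i} {j} {k} i≢j j≢k i≢k eq with first? i j k | first? j k i | first? k i j
    ... | yes (i<j , _) | yes (_ , j<i) | _ = Fin.<-asym i<j j<i
    colour′-rotates i≢j j≢k i≢k () | yes _ | no _ | yes _
    colour′-rotates i≢j j≢k i≢k () | yes _ | no _ | no _
    colour′-rotates i≢j j≢k i≢k () | no _ | yes _ | _
    colour′-rotates i≢j j≢k i≢k () | no _ | no _ | yes _
    -- Both colours are `2F` only if none of the three elements is least.
    ... | no ¬i | no ¬j | no ¬k = some-first i≢j j≢k i≢k ¬i ¬j ¬k

  -- The colour records which of `i`, `σ i`, `σ (σ i)` is least. Passing to `σ i` shifts the answer,
  -- so the three members of a nontrivial orbit get three different colours.
  colour : Fin n → Fin 3
  colour i = colour′ i (σ i) (σ (σ i))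

  colour-σ : ∀ i → colour i ≡ colour (σ i) → σ i ≡ i
  colour-σ i eq with σ i Fin.≟ i
  ... | yes fixed = fixed
  ... | no σi≢i = ⊥-elim (colour′-rotates (σi≢i ∘ sym) σi≢σσi i≢σσi
          (trans eq (cong (colour′ (σ i) (σ (σ i))) (σ³ i))))
    where
    σi≢σσi : σ i ≢ σ (σ i)
    σi≢σσi e = σi≢i (trans (sym (σ³ (σ i))) (trans (sym (cong (σ ∘ σ) e)) (σ³ i)))
    i≢σσi : i ≢ σ (σ i)
    i≢σσi e = σi≢i (trans (cong σ e) (σ³ i))

-- Arithmetic modulo `p`.

module Residues (p : ℕ) (p-prime : Prime p) where

  private instance
    p≢0 : ℕ.NonZero p
    p≢0 = prime⇒nonZero p-prime

  infix 4 _≋_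
  -- A record rather than a synonym for divisibility, so that unification can recover `x` and `y`
  -- from a congruence.
  record _≋_ (x y : ℤ) : Set where
    constructor mod
    field p∣ : + p Signed.∣ x - y
  open _≋_ public

  -- Congruences are proved by certificates: x − y is exhibited as a linear combination of the
  -- differences u − v of known congruences.
  by₁ : ∀ {x y u v} k → u ≋ v → x - y ≡ k * (u - v) → x ≋ y
  by₁ k (mod d) eq = mod (subst (+ p Signed.∣_) (sym eq) (Signed.∣n⇒∣m*n k d))

  by₂ : ∀ {x y u v u′ v′} k k′ → u ≋ v → u′ ≋ v′ → x - y ≡ k * (u - v) + k′ * (u′ - v′) → x ≋ y
  by₂ k k′ (mod d) (mod d′) eq = mod (subst (+ p Signed.∣_) (sym eq)
    (Signed.∣m∣n⇒∣m+n (Signed.∣n⇒∣m*n k d) (Signed.∣n⇒∣m*n k′ d′)))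

  ≋-reflexive : ∀ {x y} → x ≡ y → x ≋ y
  ≋-reflexive {x} refl = mod (divides 0ℤ (solve (x ∷ [])))

  ≋-refl : ∀ {x} → x ≋ x
  ≋-refl = ≋-reflexive refl

  ≋-sym : ∀ {x y} → x ≋ y → y ≋ x
  ≋-sym {x} {y} e = by₁ (- 1ℤ) e (solve (x ∷ y ∷ []))

  ≋-trans : ∀ {x y z} → x ≋ y → y ≋ z → x ≋ z
  ≋-trans {x} {y} {z} e f = by₂ 1ℤ 1ℤ e f (solve (x ∷ y ∷ z ∷ []))

  _≋?_ : ∀ x y → Dec (x ≋ y)
  x ≋? y = map′ mod p∣ (+ p Signed.∣? x - y)

  ∣⇒≋0 : ∀ {x} → + p Signed.∣ x → x ≋ 0ℤ
  ∣⇒≋0 {x} d = mod (subst (+ p Signed.∣_) (sym (ℤ.+-identityʳ x)) d)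

  ≋0⇒∣ : ∀ {x} → x ≋ 0ℤ → + p Signed.∣ x
  ≋0⇒∣ {x} (mod d) = subst (+ p Signed.∣_) (ℤ.+-identityʳ x) d

  integral : ∀ {x y} → x * y ≋ 0ℤ → x ≋ 0ℤ ⊎ y ≋ 0ℤ
  integral {x} {y} e with euclidsLemma ∣ x ∣ ∣ y ∣ p-prime (subst (p ℕ.∣_) (ℤ.abs-* x y) (∣⇒∣ᵤ (≋0⇒∣ e)))
  ... | inj₁ d = inj₁ (∣⇒≋0 (∣ᵤ⇒∣ d))
  ... | inj₂ d = inj₂ (∣⇒≋0 (∣ᵤ⇒∣ d))

  Unit : ℤ → Set
  Unit x = ¬ (x ≋ 0ℤ)

  cancel-zero : ∀ {x y} → Unit x → x * y ≋ 0ℤ → y ≋ 0ℤ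
  cancel-zero x≢0 e with integral e
  ... | inj₁ x≋0 = ⊥-elim (x≢0 x≋0)
  ... | inj₂ y≋0 = y≋0

  cancel : ∀ {k x y} → Unit k → k * x ≋ k * y → x ≋ y
  cancel {k} {x} {y} k≢0 e =
    by₁ 1ℤ (cancel-zero {y = x - y} k≢0 (by₁ 1ℤ e (solve (k ∷ x ∷ y ∷ [])))) (solve (x ∷ y ∷ []))

  cube-zero : ∀ {x} → x * x * x ≋ 0ℤ → x ≋ 0ℤ
  cube-zero {x} e with integral {x * x} e
  ... | inj₂ d = d
  ... | inj₁ d with integral {x} d
  ...   | inj₁ d′ = d′
  ...   | inj₂ d′ = d′

  ⟦_⟧ : Fin p → ℤ
  ⟦ i ⟧ = + toℕ i

  opaque
    residue : ℤ → Fin p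
    residue x = fromℕ< (n%ℕd<d x p)

    ⟦residue⟧ : ∀ x → ⟦ residue x ⟧ ≋ x
    ⟦residue⟧ x = mod (divides (- q) (begin
      ⟦ residue x ⟧ - x  ≡⟨ cong₂ (λ s t → + s - t) (Fin.toℕ-fromℕ< (n%ℕd<d x p)) (a≡a%ℕn+[a/ℕn]*n x p) ⟩
      r - (r + q * + p)  ≡⟨ regroup r q (+ p) ⟩
      - q * + p          ∎))
      where
      open ≡-Reasoning
      q r : ℤ
      q = x /ℕ p
      r = + (x %ℕ p)
      regroup : ∀ r q m → r - (r + q * m) ≡ - q * m
      regroup r q m = solve (r ∷ q ∷ m ∷ [])

  -- Both representatives lie between 0 and `p - 1`, so their distance is a multiple of `p` below
  -- `p`.
  ⟦⟧-injective : ∀ {i j} → ⟦ i ⟧ ≋ ⟦ j ⟧ → i ≡ j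
  ⟦⟧-injective {i} {j} (mod d) =
    Fin.toℕ-injective (ℤ.+-injective (ℤ.i-j≡0⇒i≡j ⟦ i ⟧ ⟦ j ⟧ (ℤ.∣i∣≡0⇒i≡0 distance≡0)))
    where
    distance<p : ∣ ⟦ i ⟧ - ⟦ j ⟧ ∣ ℕ.< p
    distance<p = ℕ.≤-<-trans
      (subst (ℕ._≤ toℕ i ℕ.⊔ toℕ j) (cong ∣_∣ (sym (ℤ.m-n≡m⊖n (toℕ i) (toℕ j))))
        (ℤ.∣m⊝n∣≤m⊔n (toℕ i) (toℕ j)))
      (ℕ.⊔-lub (Fin.toℕ<n i) (Fin.toℕ<n j))
    small⇒≡0 : ∀ n → p ℕ.∣ n → n ℕ.< p → n ≡ 0
    small⇒≡0 zero    _ _   = refl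
    small⇒≡0 (suc n) e n<p = ⊥-elim (ℕ.<⇒≱ n<p (ℕ.∣⇒≤ e))
    distance≡0 : ∣ ⟦ i ⟧ - ⟦ j ⟧ ∣ ≡ 0
    distance≡0 = small⇒≡0 _ (∣⇒∣ᵤ d) distance<p

  residue-unique : ∀ {x i} → x ≋ ⟦ i ⟧ → residue x ≡ i
  residue-unique {x} e = ⟦⟧-injective (≋-trans (⟦residue⟧ x) e)

  -- Followed by `residue`, `f` becomes an injection of a finite set into itself. All counting
  -- modulo `p` goes through this: inverses, cube roots, the covering by cosets and the final
  -- contradiction.
  surjective : (f : Fin p → ℤ) → (∀ i j → f i ≋ f j → i ≡ j) → ∀ y → ∃[ i ] f i ≋ y
  surjective f f-injective y =
      Product.map₂ agree (injection⇒surjection (residue ∘ f) (λ i j → f-injective i j ∘ agree) (residue y))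
    where
    agree : ∀ {x z} → residue x ≡ residue z → x ≋ z
    agree {x} {z} eq = ≋-trans (≋-sym (⟦residue⟧ x)) (≋-trans (≋-reflexive (cong ⟦_⟧ eq)) (⟦residue⟧ z))

  -- Multiplication by a unit is injective on residues, so it attains 1.
  inverse : ∀ {x} → Unit x → ∃[ v ] v * x ≋ 1ℤ
  inverse {x} x≢0 = ⟦ proj₁ hit ⟧ , ≋-trans (≋-reflexive (commute ⟦ proj₁ hit ⟧)) (proj₂ hit)
    where
    hit : ∃[ i ] x * ⟦ i ⟧ ≋ 1ℤ
    hit = surjective (λ i → x * ⟦ i ⟧) (λ i j e → ⟦⟧-injective (cancel x≢0 e)) 1ℤ
    commute : ∀ y → y * x ≡ x * y
    commute y = solve (x ∷ y ∷ [])

-- Cubes and cube roots of unity modulo `p`.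

module Cubes (p : ℕ) (p-prime : Prime p) where
  open Residues p p-prime

  unit-product : ∀ {x y} → Unit x → Unit y → Unit (x * y)
  unit-product x≢0 y≢0 e = y≢0 (cancel-zero x≢0 e)

  unit-three : p ≢ 3 → Unit (+ 3)
  unit-three p≢3 e = case prime⇒irreducible (toWitness {a? = prime? 3} tt) (∣⇒∣ᵤ (≋0⇒∣ e)) of λ where
    (inj₁ refl) → ¬prime[1] p-prime
    (inj₂ p≡3)  → p≢3 p≡3

  ≋-from-difference : ∀ {x y} → x - y ≋ 0ℤ → x ≋ y
  ≋-from-difference {x} {y} d = by₁ 1ℤ d (solve (x ∷ y ∷ []))

  +-cong : ∀ {x x′ y y′} → x ≋ x′ → y ≋ y′ → x + y ≋ x′ + y′
  +-cong {x} {x′} {y} {y′} e f = by₂ 1ℤ 1ℤ e f (solve (x ∷ x′ ∷ y ∷ y′ ∷ []))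

  +-congʳ : ∀ {x x′ y} → x ≋ x′ → x + y ≋ x′ + y
  +-congʳ e = +-cong e ≋-refl

  *-congˡ : ∀ k {x y} → x ≋ y → k * x ≋ k * y
  *-congˡ k {x} {y} e = by₁ k e (solve (k ∷ x ∷ y ∷ []))

  inverse-unique : ∀ {x y v} → x * v ≋ 1ℤ → v * y ≋ 1ℤ → x ≋ y
  inverse-unique {x} {y} {v} e f = by₂ y (- x) e f (solve (x ∷ y ∷ v ∷ []))

  cube-cong : ∀ {x y} → x ≋ y → x * x * x ≋ y * y * y
  cube-cong {x} {y} e = by₁ (x * x + x * y + y * y) e (solve (x ∷ y ∷ []))

  1≢0 : Unit 1ℤ
  1≢0 e = case ℕ.∣1⇒≡1 (∣⇒∣ᵤ (≋0⇒∣ e)) of λ where refl → ¬prime[1] p-prime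

  -- The cofactor of `ω - 1` in `ω³ - 1` vanishes: `ω` is a cube root of unity, primitive when
  -- `p ≢ 3`.
  Ω : ℤ → Set
  Ω ω = ω * ω + ω + 1ℤ ≋ 0ℤ

  -- By `1 + ω² ≋ - ω`, the product `(x - y)(y - ωx)(x - ωy)` is congruent to `- ω(x³ - y³)`.
  equal-cubes : ∀ {ω x y} → Ω ω → x * x * x ≋ y * y * y → x ≋ y ⊎ y ≋ ω * x ⊎ x ≋ ω * y
  equal-cubes {ω} {x} {y} ω-root e = case integral {x - y} product≋0 of λ where
      (inj₁ d) → inj₁ (≋-from-difference d)
      (inj₂ d) → case integral {y - ω * x} d of λ where
        (inj₁ d′) → inj₂ (inj₁ (≋-from-difference d′))
        (inj₂ d′) → inj₂ (inj₂ (≋-from-difference d′))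
    where
    product≋0 : (x - y) * ((y - ω * x) * (x - ω * y)) ≋ 0ℤ
    product≋0 = by₂ (- ω) ((x - y) * (x * y)) e ω-root (solve (x ∷ y ∷ ω ∷ []))

  -- For `y` a unit, the quotient `x/y` is a root of `t³ - 1 = (t - 1)(t² + t + 1)`, and only the
  -- first factor can vanish.
  cube-injective : (∀ i → ¬ Ω ⟦ i ⟧) → ∀ {x y} → x * x * x ≋ y * y * y → x ≋ y
  cube-injective no-ω {x} {y} e = case y ≋? 0ℤ of λ where
      (yes y≋0) → ≋-trans (cube-zero (≋-trans e (cube-cong y≋0))) (≋-sym y≋0)
      (no y≢0)  → from-inverse (inverse y≢0)
    where
    from-inverse : ∃[ v ] v * y ≋ 1ℤ → x ≋ y
    from-inverse (v , vy≋1) = case integral {x * v - 1ℤ} ω³≋1 of λ where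
        (inj₁ d) → inverse-unique (≋-from-difference d) vy≋1
        (inj₂ d) → ⊥-elim (no-ω (residue ω) (residue-root d))
      where
      ω : ℤ
      ω = x * v
      ω³≋1 : (x * v - 1ℤ) * (x * v * (x * v) + x * v + 1ℤ) ≋ 0ℤ
      ω³≋1 = by₂ (v * v * v) (v * y * (v * y) + v * y + 1ℤ) e vy≋1 (solve (x ∷ y ∷ v ∷ []))
      residue-root : ∀ {ω} → Ω ω → Ω ⟦ residue ω ⟧
      residue-root {ω} d = root (⟦residue⟧ ω)
        where
        root : ∀ {r} → r ≋ ω → Ω r
        root {r} f = by₂ (r + ω + 1ℤ) 1ℤ f d (solve (r ∷ ω ∷ []))

  -- For units `a` and `b`: the cosets `aH` and `bH` of the group `H` of nonzero cubes are disjoint.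
  Separate : ℤ → ℤ → Set
  Separate a b = ∀ {x y} → a * (x * x * x) ≋ b * (y * y * y) → x ≋ 0ℤ × y ≋ 0ℤ

  separate-sym : ∀ a b → Separate a b → Separate b a
  separate-sym a b sep e = Product.swap (sep (≋-sym e))

  -- Counting with the cosets `aH`, `bH`, `cH` when `t² + t + 1` has a root.

  module Cosets {ω} (ω-root : Ω ω) (coef : Fin 3 → ℤ) (coef-unit : ∀ i → Unit (coef i))
                (separate : ∀ {i j} → i ≢ j → Separate (coef i) (coef j)) where

    σ : Fin p → Fin p
    σ i = residue (ω * ⟦ i ⟧)

    ⟦σ⟧ : ∀ i → ⟦ σ i ⟧ ≋ ω * ⟦ i ⟧
    ⟦σ⟧ i = ⟦residue⟧ (ω * ⟦ i ⟧)

    σ³ : ∀ i → σ (σ (σ i)) ≡ i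
    σ³ i = ⟦⟧-injective (≋-trans (⟦σ⟧ (σ (σ i))) (collapse (⟦σ⟧ i) (⟦σ⟧ (σ i))))
      where
      collapse : ∀ {x y z} → y ≋ ω * x → z ≋ ω * y → ω * z ≋ x
      collapse {x} {y} {z} e f = ≋-trans {ω * z} {ω * ω * ω * x}
        (by₂ ω (ω * ω) f e (solve (x ∷ y ∷ z ∷ ω ∷ [])))
        (by₁ ((ω - 1ℤ) * x) ω-root (solve (x ∷ ω ∷ [])))

    open Rotation σ σ³

    -- σ permutes each fibre of the cube map on nonzero residues cyclically, so the colours make ψ
    -- injective although cubing is three-to-one.
    ψ : Fin p → ℤ
    ψ i = coef (colour i) * (⟦ i ⟧ * ⟦ i ⟧ * ⟦ i ⟧)

    -- Residues with equal cubes are equal or one `σ` apart, in one direction or the other. In the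
    -- latter case equal colours make `σ` fix the residue, so the two agree.
    same-cube : ∀ {i j} → colour i ≡ colour j → ⟦ i ⟧ * ⟦ i ⟧ * ⟦ i ⟧ ≋ ⟦ j ⟧ * ⟦ j ⟧ * ⟦ j ⟧ → i ≡ j
    same-cube {i} {j} same e = case equal-cubes {ω} {⟦ i ⟧} {⟦ j ⟧} ω-root e of λ where
        (inj₁ d)        → ⟦⟧-injective d
        (inj₂ (inj₁ d)) → fixed same d
        (inj₂ (inj₂ d)) → sym (fixed (sym same) d)
      where
      fixed : ∀ {i j} → colour i ≡ colour j → ⟦ j ⟧ ≋ ω * ⟦ i ⟧ → i ≡ j
      fixed {i} {j} same d = trans (sym (colour-σ i (trans same (cong colour (sym σi≡j))))) σi≡j
        where
        σi≡j : σ i ≡ j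
        σi≡j = residue-unique (≋-sym d)

    ψ-injective : ∀ i j → ψ i ≋ ψ j → i ≡ j
    ψ-injective i j e = case colour i Fin.≟ colour j of λ where
        (yes same) → same-cube same (cancel (coef-unit (colour i))
          (≋-trans e (≋-reflexive (cong (λ k → coef k * _) (sym same)))))
        -- Values in distinct cosets agree only when both residues are 0.
        (no differ) → case separate differ {⟦ i ⟧} {⟦ j ⟧} e of λ where
          (i≋0 , j≋0) → ⟦⟧-injective (≋-trans i≋0 (≋-sym j≋0))

    -- `ψ` is injective modulo `p`, hence onto: this is the count by which three disjoint cosets
    -- exhaust the nonzero residues.
    cover : ∀ t → ∃[ k ] ∃[ w ] coef k * (w * w * w) ≋ t
    cover t = Product.map colour (λ {i} e → ⟦ i ⟧ , e) (surjective ψ ψ-injective t)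

    private
      a = coef 0F
      b = coef 1F
      c = coef 2F

      a-unit : Unit a
      a-unit = coef-unit 0F

      b-unit : Unit b
      b-unit = coef-unit 1F

      separate-ab : Separate a b
      separate-ab = separate λ ()

    -- Membership in `A = aH ∪ {0}`, as `⟦ i ⟧` may vanish. Quantifying over representatives makes
    -- it decidable.
    InCoset : ℤ → Set
    InCoset t = ∃[ i ] t ≋ a * (⟦ i ⟧ * ⟦ i ⟧ * ⟦ i ⟧)

    inCoset : ∀ {t} u → t ≋ a * (u * u * u) → InCoset t
    inCoset u e = residue u , ≋-trans e (*-congˡ a (cube-cong (≋-sym (⟦residue⟧ u))))

    -- Here v is the inverse of w where t + b = aw³ or bw³, and s is the image of t; residues outside A
    -- stay fixed, so that the map is defined on all of them.
    data Step (t s : ℤ) : Set where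
      to-a    : ∀ {v r} → Unit v → s ≋ a * (r * r * r) → t * (v * v * v) ≋ s →
                s + b * (v * v * v) ≋ a → Step t s
      to-b    : ∀ {v r} → Unit v → s ≋ a * (v * v * v) → t * (v * v * v) ≋ a * (r * r * r) →
                a * (r * r * r) + b * (v * v * v) ≋ b → Step t s
      outside : ¬ InCoset t → s ≋ t → Step t s

    -- For `t = au³` in `A`, `cover` writes `t + b` as a coefficient times `w³`. The coefficient `c`
    -- is excluded by hypothesis; in the other two cases multiplying by `v³ = w⁻³` gives the
    -- required equations.
    step : (∀ u w → ¬ (c * (w * w * w) ≋ a * (u * u * u) + b)) → ∀ t → ∃[ s ] Step t s
    step no-sum t = case Fin.any? (λ i → t ≋? (a * (⟦ i ⟧ * ⟦ i ⟧ * ⟦ i ⟧))) of λ where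
        (no t∉A)        → t , outside t∉A ≋-refl
        (yes (i , t∈A)) → inside ⟦ i ⟧ t∈A (cover (a * (⟦ i ⟧ * ⟦ i ⟧ * ⟦ i ⟧) + b))
      where
      scale-a : ∀ {u w v} → t ≋ a * (u * u * u) → a * (w * w * w) ≋ a * (u * u * u) + b → v * w ≋ 1ℤ →
                t * (v * v * v) + b * (v * v * v) ≋ a
      scale-a {u} {w} {v} t∈A e vw≋1 = scale a b (≋-trans (+-congʳ t∈A) (≋-sym e))
        where
        scale : ∀ a b → t + b ≋ a * (w * w * w) → t * (v * v * v) + b * (v * v * v) ≋ a
        -- The second multiplier comes from factoring `(vw)³ - 1` through `vw - 1`.
        scale a b f = by₂ (v * v * v) (a * (v * w * (v * w) + v * w + 1ℤ)) f vw≋1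
                        (solve (t ∷ a ∷ b ∷ v ∷ w ∷ []))

      scale-b : ∀ a b {u w v} → b * (w * w * w) ≋ a * (u * u * u) + b → v * w ≋ 1ℤ →
                a * (u * v * (u * v) * (u * v)) + b * (v * v * v) ≋ b
      scale-b a b {u} {w} {v} e vw≋1 =
        by₂ (- (v * v * v)) (b * (v * w * (v * w) + v * w + 1ℤ)) e vw≋1
          (solve (a ∷ b ∷ u ∷ v ∷ w ∷ []))

      scale-t : ∀ a {u v} → t ≋ a * (u * u * u) → t * (v * v * v) ≋ a * (u * v * (u * v) * (u * v))
      scale-t a {u} {v} e = by₁ (v * v * v) e (solve (t ∷ a ∷ u ∷ v ∷ []))

      move : ∀ a b {u} → 0ℤ ≋ a * (u * u * u) + b → a * (u * u * u) ≋ b * (- 1ℤ * - 1ℤ * - 1ℤ)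
      move a b {u} e = by₁ (- 1ℤ) e (solve (a ∷ b ∷ u ∷ []))

      -- If `w` vanished, then `au³ ≋ - b = b(-1)³`, and separation would make -1 vanish.
      w-unit : ∀ {k u w} → coef k * (w * w * w) ≋ a * (u * u * u) + b → Unit w
      w-unit {k} {u} {w} e w≋0 = 1≢0 (negate (proj₂ (separate-ab {u} { - 1ℤ} (move a b {u}
          (≋-trans (≋-trans (≋-reflexive (sym (ℤ.*-zeroʳ (coef k))))
            (*-congˡ (coef k) (≋-sym (cube-cong {w} {0ℤ} w≋0)))) e)))))
        where
        negate : - 1ℤ ≋ 0ℤ → 1ℤ ≋ 0ℤ
        negate f = by₁ (- 1ℤ) f refl

      inverse-unit : ∀ {v w} → v * w ≋ 1ℤ → Unit v
      inverse-unit {v} {w} e v≋0 = 1≢0 (by₂ (- 1ℤ) w e v≋0 (solve (v ∷ w ∷ [])))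

      inside : ∀ u → t ≋ a * (u * u * u) →
               ∃[ k ] ∃[ w ] coef k * (w * w * w) ≋ a * (u * u * u) + b → ∃[ s ] Step t s
      inside u t∈A (0F , w , e) = case inverse {w} (w-unit {0F} {u} e) of λ where
        (v , vw≋1) → t * (v * v * v) , to-a {v = v} {r = u * v} (inverse-unit {v} {w} vw≋1)
          (scale-t a {u} {v} t∈A) ≋-refl (scale-a {u} {w} {v} t∈A e vw≋1)
      inside u t∈A (1F , w , e) = case inverse {w} (w-unit {1F} {u} e) of λ where
        (v , vw≋1) → a * (v * v * v) , to-b {v = v} {r = u * v} (inverse-unit {v} {w} vw≋1)
          ≋-refl (scale-t a {u} {v} t∈A) (scale-b a b {u} {w} {v} e vw≋1)
      inside u t∈A (2F , w , e) = ⊥-elim (no-sum u w e)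

    -- The images of the two cases are disjoint: subtracting from a turns them into elements of bH and of
    -- a²b⁻¹H.
    step-clash : ∀ {s s′ v v′ r′} → s ≋ s′ → Unit v → s + b * (v * v * v) ≋ a →
                 s′ ≋ a * (v′ * v′ * v′) → a * (r′ * r′ * r′) + b * (v′ * v′ * v′) ≋ b → ⊥
    step-clash {s} {s′} {v} {v′} {r′} e v-unit f f′ g =
        unit-product b-unit v-unit (proj₁ (separate-ab {b * v} {a * r′}
          (combine a b (≋-trans (+-congʳ (≋-sym (≋-trans e f′))) f) g)))
      where
      combine : ∀ a b → a * (v′ * v′ * v′) + b * (v * v * v) ≋ a →
                a * (r′ * r′ * r′) + b * (v′ * v′ * v′) ≋ b →
                a * (b * v * (b * v) * (b * v)) ≋ b * (a * r′ * (a * r′) * (a * r′))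
      -- Eliminating `v′³` gives `b²v³ ≋ a²r′³`; the extra factor `ab` turns the sides into `a` and
      -- `b` times cubes, as `separate-ab` needs.
      combine a b f g = by₂ (a * b * b) (- (a * b * a)) f g (solve (a ∷ b ∷ v ∷ v′ ∷ r′ ∷ []))

    -- In `to-a` the image determines `bv³ = a - s`, in `to-b` it determines `av³ = s`; either way
    -- the unit `v³` is known, and then `t`. Mixed cases clash, and a fixed residue outside `A`
    -- cannot equal an image in `A`.
    step-injective : ∀ {t t′ s s′} → Step t s → Step t′ s′ → s ≋ s′ → t ≋ t′
    step-injective {t} {t′} {s} {s′} (to-a {v} v-unit _ f g) (to-a {v′} _ _ f′ g′) e =
        cancel (unit-product (unit-product v-unit v-unit) v-unit)
          (scaled (cancel b-unit (bv³-agree a b e g g′)) (≋-trans f (≋-trans e (≋-sym f′))))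
      where
      bv³-agree : ∀ a b → s ≋ s′ → s + b * (v * v * v) ≋ a → s′ + b * (v′ * v′ * v′) ≋ a →
                  b * (v * v * v) ≋ b * (v′ * v′ * v′)
      bv³-agree a b e g g′ = ≋-trans {y = a - s′} (by₂ 1ℤ (- 1ℤ) g e (solve (a ∷ b ∷ s ∷ s′ ∷ v ∷ [])))
                             (≋-sym (by₁ 1ℤ g′ (solve (a ∷ b ∷ s′ ∷ v′ ∷ []))))
      scaled : v * v * v ≋ v′ * v′ * v′ → t * (v * v * v) ≋ t′ * (v′ * v′ * v′) →
               v * v * v * t ≋ v * v * v * t′
      scaled h k = by₂ 1ℤ (- t′) k h (solve (t ∷ t′ ∷ v ∷ v′ ∷ []))
    step-injective {t} {t′} {s} {s′} (to-b {v} {r} v-unit f g h) (to-b {v′} {r′} _ f′ g′ h′) e =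
        cancel (unit-product (unit-product v-unit v-unit) v-unit)
          (scaled b v³≋ (isolate b g h) (isolate b g′ h′))
      where
      v³≋ : v * v * v ≋ v′ * v′ * v′
      v³≋ = cancel a-unit (≋-trans (≋-sym f) (≋-trans e f′))
      isolate : ∀ b {x y z} → x ≋ y → y + b * z ≋ b → x + b * z ≋ b
      isolate b {x} {y} {z} g h = ≋-trans (+-congʳ g) h
      scaled : ∀ b → v * v * v ≋ v′ * v′ * v′ → t * (v * v * v) + b * (v * v * v) ≋ b →
               t′ * (v′ * v′ * v′) + b * (v′ * v′ * v′) ≋ b → v * v * v * t ≋ v * v * v * t′
      scaled b k g g′ = ≋-trans {y = b - b * (v * v * v)} (by₁ 1ℤ g (solve (t ∷ b ∷ v ∷ [])))
        (≋-sym (by₂ 1ℤ (b + t′) g′ k (solve (t′ ∷ b ∷ v ∷ v′ ∷ []))))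
    step-injective (outside _ f) (outside _ f′) e = ≋-trans (≋-sym f) (≋-trans e f′)
    step-injective (to-a {v} v-unit _ _ g) (to-b {v′} {r′} _ f _ h) e =
      ⊥-elim (step-clash {v = v} {v′} {r′} e v-unit g f h)
    step-injective (to-b {v′} {r′} _ f _ h) (to-a {v} v-unit _ _ g) e =
      ⊥-elim (step-clash {v = v} {v′} {r′} (≋-sym e) v-unit g f h)
    step-injective (to-a {r = r} _ f _ _) (outside t∉A f′) e =
      ⊥-elim (t∉A (inCoset r (≋-trans (≋-sym f′) (≋-trans (≋-sym e) f))))
    step-injective (to-b {v} _ f _ _) (outside t∉A f′) e =
      ⊥-elim (t∉A (inCoset v (≋-trans (≋-sym f′) (≋-trans (≋-sym e) f))))
    step-injective (outside t∉A f′) (to-a {r = r} _ f _ _) e =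
      ⊥-elim (t∉A (inCoset r (≋-trans (≋-sym f′) (≋-trans e f))))
    step-injective (outside t∉A f′) (to-b {v} _ f _ _) e =
      ⊥-elim (t∉A (inCoset v (≋-trans (≋-sym f′) (≋-trans e f))))

    -- The image 0 would mean `a ≋ bv³` against separation, or a vanishing unit `v`, or that 0 lies
    -- outside `A`.
    step-misses-0 : ∀ {t s} → Step t s → ¬ (s ≋ 0ℤ)
    step-misses-0 {t} {s} (to-a {v} _ _ _ g) e = 1≢0 (proj₁ (separate-ab {1ℤ} {v} (rewritten a b g)))
      where
      rewritten : ∀ a b → s + b * (v * v * v) ≋ a → a * (1ℤ * 1ℤ * 1ℤ) ≋ b * (v * v * v)
      rewritten a b g = by₂ (- 1ℤ) 1ℤ g e (solve (a ∷ b ∷ s ∷ v ∷ []))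
    step-misses-0 (to-b v-unit f _ _) e = v-unit (cube-zero (cancel-zero a-unit (≋-trans (≋-sym f) e)))
    step-misses-0 (outside t∉A f) e =
      t∉A (inCoset 0ℤ (≋-trans (≋-sym f) (≋-trans e (≋-reflexive (sym (ℤ.*-zeroʳ a))))))

    contradictory : (∀ u w → ¬ (c * (w * w * w) ≋ a * (u * u * u) + b)) → ⊥
    contradictory no-sum = case surjective (λ i → proj₁ (next i)) injective 0ℤ of λ where
        (i , e) → step-misses-0 (proj₂ (next i)) e
      where
      next : ∀ i → ∃[ s ] Step ⟦ i ⟧ s
      next i = step no-sum ⟦ i ⟧
      injective : ∀ i j → proj₁ (next i) ≋ proj₁ (next j) → i ≡ j
      injective i j e = ⟦⟧-injective (step-injective (proj₂ (next i)) (proj₂ (next j)) e)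

  -- A nontrivial zero of the cubic modulo `p`.

  Zero : (a b c x y z : ℤ) → Set
  Zero a b c x y z = a * (x * x * x) + b * (y * y * y) + c * (z * z * z) ≋ 0ℤ

  -- Coordinates are representatives, so existence is decidable and may be proved by contradiction.
  Solution : (a b c : ℤ) → Set
  Solution a b c = ∃[ i ] ∃[ j ] ∃[ k ] Zero a b c ⟦ i ⟧ ⟦ j ⟧ ⟦ k ⟧ × (Unit ⟦ i ⟧ ⊎ Unit ⟦ j ⟧ ⊎ Unit ⟦ k ⟧)

  solution? : ∀ a b c → Dec (Solution a b c)
  solution? a b c = Fin.any? λ i → Fin.any? λ j → Fin.any? λ k →
    ((a * (⟦ i ⟧ * ⟦ i ⟧ * ⟦ i ⟧) + b * (⟦ j ⟧ * ⟦ j ⟧ * ⟦ j ⟧) + c * (⟦ k ⟧ * ⟦ k ⟧ * ⟦ k ⟧)) ≋? 0ℤ)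
    ×-dec (¬? (⟦ i ⟧ ≋? 0ℤ) ⊎-dec (¬? (⟦ j ⟧ ≋? 0ℤ) ⊎-dec ¬? (⟦ k ⟧ ≋? 0ℤ)))

  solution : ∀ a b c x y z → Zero a b c x y z → Unit x ⊎ Unit y ⊎ Unit z → Solution a b c
  solution a b c x y z e nontrivial = residue x , residue y , residue z ,
      ≋-trans (+-cong (+-cong (*-congˡ a (cube-cong (⟦residue⟧ x))) (*-congˡ b (cube-cong (⟦residue⟧ y))))
        (*-congˡ c (cube-cong (⟦residue⟧ z)))) e ,
      Sum.map unit-residue (Sum.map unit-residue unit-residue) nontrivial
    where
    unit-residue : ∀ {u} → Unit u → Unit ⟦ residue u ⟧
    unit-residue {u} u≢0 f = u≢0 (≋-trans (≋-sym (⟦residue⟧ u)) f)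

  -- If `t² + t + 1` has no root, cubing is a bijection and `ax³` takes the value `- b`. If it has
  -- one, the absence of a zero separates the three cosets, and an equation `cw³ ≋ au³ + b` would be
  -- the zero `(u, 1, - w)`.
  solvable : p ≢ 3 → ∀ {a b c} → Unit a → Unit b → Unit c → Solution a b c
  solvable p≢3 {a} {b} {c} a-unit b-unit c-unit =
      decidable-stable (solution? a b c) λ none →
      case Fin.any? (λ i → (⟦ i ⟧ * ⟦ i ⟧ + ⟦ i ⟧ + 1ℤ) ≋? 0ℤ) of λ where
        (no no-ω) → none (from-bijection (surjective (λ i → a * (⟦ i ⟧ * ⟦ i ⟧ * ⟦ i ⟧))
            (λ i j e → ⟦⟧-injective (cube-injective (λ i root → no-ω (i , root)) (cancel a-unit e))) (- b)))
        (yes (i , root)) → Cosets.contradictory {⟦ i ⟧} root coef coef-unit (λ {i} {j} → separate none i j)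
            (λ u w e → none (solution a b c u 1ℤ (- w) (sum-zero u w e) (inj₂ (inj₁ 1≢0))))
    where
    from-bijection : ∃[ i ] a * (⟦ i ⟧ * ⟦ i ⟧ * ⟦ i ⟧) ≋ - b → Solution a b c
    from-bijection (i , e) = solution a b c ⟦ i ⟧ 1ℤ 0ℤ (form-zero ⟦ i ⟧ e) (inj₂ (inj₁ 1≢0))
      where
      form-zero : ∀ x → a * (x * x * x) ≋ - b → Zero a b c x 1ℤ 0ℤ
      form-zero x e = by₁ 1ℤ e (solve (a ∷ b ∷ c ∷ x ∷ []))

    sum-zero : ∀ u w → c * (w * w * w) ≋ a * (u * u * u) + b → Zero a b c u 1ℤ (- w)
    sum-zero u w e = by₁ (- 1ℤ) e (solve (a ∷ b ∷ c ∷ u ∷ w ∷ []))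

    coef : Fin 3 → ℤ
    coef 0F = a
    coef 1F = b
    coef 2F = c

    coef-unit : ∀ i → Unit (coef i)
    coef-unit 0F = a-unit
    coef-unit 1F = b-unit
    coef-unit 2F = c-unit

    separate-unless : ∀ a b → Unit b → (∀ x y → Unit x → ¬ (a * (x * x * x) ≋ b * (y * y * y))) → Separate a b
    separate-unless a b b-unit clash {x} {y} e = case x ≋? 0ℤ of λ where
      (no x≢0)  → ⊥-elim (clash x y x≢0 e)
      (yes x≋0) → x≋0 , cube-zero (cancel-zero b-unit
        (≋-trans (≋-sym e) (≋-trans (*-congˡ a (cube-cong x≋0)) (≋-reflexive (ℤ.*-zeroʳ a)))))

    -- As -1 is a cube, a common value of two of the terms is a zero of the form.
    ab-zero : ∀ x y → a * (x * x * x) ≋ b * (y * y * y) → Zero a b c x (- y) 0ℤ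
    ab-zero x y e = by₁ 1ℤ e (solve (a ∷ b ∷ c ∷ x ∷ y ∷ []))

    ac-zero : ∀ x z → a * (x * x * x) ≋ c * (z * z * z) → Zero a b c x 0ℤ (- z)
    ac-zero x z e = by₁ 1ℤ e (solve (a ∷ b ∷ c ∷ x ∷ z ∷ []))

    bc-zero : ∀ y z → b * (y * y * y) ≋ c * (z * z * z) → Zero a b c 0ℤ y (- z)
    bc-zero y z e = by₁ 1ℤ e (solve (a ∷ b ∷ c ∷ y ∷ z ∷ []))

    separate-ab : ¬ Solution a b c → Separate a b
    separate-ab none = separate-unless a b b-unit λ x y x≢0 e →
      none (solution a b c x (- y) 0ℤ (ab-zero x y e) (inj₁ x≢0))

    separate-ac : ¬ Solution a b c → Separate a c
    separate-ac none = separate-unless a c c-unit λ x z x≢0 e →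
      none (solution a b c x 0ℤ (- z) (ac-zero x z e) (inj₁ x≢0))

    separate-bc : ¬ Solution a b c → Separate b c
    separate-bc none = separate-unless b c c-unit λ y z y≢0 e →
      none (solution a b c 0ℤ y (- z) (bc-zero y z e) (inj₂ (inj₁ y≢0)))

    separate : ¬ Solution a b c → ∀ i j → i ≢ j → Separate (coef i) (coef j)
    separate none 0F 0F i≢j = ⊥-elim (i≢j refl)
    separate none 0F 1F _   = separate-ab none
    separate none 0F 2F _   = separate-ac none
    separate none 1F 0F _   = separate-sym a b (separate-ab none)
    separate none 1F 1F i≢j = ⊥-elim (i≢j refl)
    separate none 1F 2F _   = separate-bc none
    separate none 2F 0F _   = separate-sym a c (separate-ac none)
    separate none 2F 1F _   = separate-sym b c (separate-bc none)
    separate none 2F 2F i≢j = ⊥-elim (i≢j refl)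

-- Hensel lifting of a zero modulo `p`.

module Hensel (p : ℕ) (p-prime : Prime p) (p≢3 : p ≢ 3) where
  open Residues p p-prime
  open Cubes p p-prime

  private
    taylor : ∀ a x D h → a * ((x + h) * (x + h) * (x + h)) + D ≡
             (a * (x * x * x) + D) + h * (a * (x * x) + a * (x * x) + a * (x * x)) +
             h * h * (a * x + a * x + a * x + a * h)
    taylor a x D h = solve (a ∷ x ∷ D ∷ h ∷ [])

    lift-error : ∀ m v T R P → m * P + - (m * v) * P * T + - (m * v) * P * (- (m * v) * P) * R ≡
                 - m * (v * T - 1ℤ) * P + P * P * (m * v * (m * v) * R)
    lift-error m v T R P = solve (m ∷ v ∷ T ∷ R ∷ P ∷ [])

    collect : ∀ m t S π Q → - m * (t * π) * (π * Q) + π * Q * (π * Q) * S ≡ (- m * t + Q * S) * (π * (π * Q))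
    collect m t S π Q = solve (m ∷ t ∷ S ∷ π ∷ Q ∷ [])

  -- A Newton step for `aX³ + D`, from modulus `πQ` to `π(πQ)`. Since `v` inverts the derivative
  -- `T = 3ax²` modulo `π`, the correction `h` cancels the error `m(πQ)` up to a multiple of
  -- `π(πQ)`; the terms of higher order contain `(πQ)²`.
  newton : ∀ {a x D m v t} π Q → a * (x * x * x) + D ≡ m * (π * Q) →
           v * (a * (x * x) + a * (x * x) + a * (x * x)) - 1ℤ ≡ t * π →
           let y = x + - (m * v) * (π * Q) in π * (π * Q) Signed.∣ a * (y * y * y) + D
  newton {a} {x} {D} {m} {v} {t} π Q e f = divides (- m * t + Q * S) (begin
      a * ((x + h) * (x + h) * (x + h)) + D         ≡⟨ taylor a x D h ⟩
      (a * (x * x * x) + D) + h * T + h * h * U     ≡⟨ cong (λ E → E + h * T + h * h * U) e ⟩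
      m * (π * Q) + h * T + h * h * U               ≡⟨ lift-error m v T U (π * Q) ⟩
      - m * (v * T - 1ℤ) * (π * Q) + π * Q * (π * Q) * S
        ≡⟨ cong (λ E → - m * E * (π * Q) + π * Q * (π * Q) * S) f ⟩
      - m * (t * π) * (π * Q) + π * Q * (π * Q) * S ≡⟨ collect m t S π Q ⟩
      (- m * t + Q * S) * (π * (π * Q))             ∎)
    where
    open ≡-Reasoning
    h = - (m * v) * (π * Q)
    T = a * (x * x) + a * (x * x) + a * (x * x)
    U = a * x + a * x + a * x + a * h
    S = m * v * (m * v) * U

  +p^suc : ∀ k → + (p ℕ.^ suc k) ≡ + p * + (p ℕ.^ k)
  +p^suc k = ℤ.pos-* p (p ℕ.^ k)

  derivative-unit : ∀ {a x} → Unit a → Unit x → Unit (a * (x * x) + a * (x * x) + a * (x * x))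
  derivative-unit {a} {x} a-unit x-unit e =
      unit-product (unit-three p≢3) (unit-product a-unit (unit-product x-unit x-unit))
      (≋-trans (≋-reflexive (triple (a * (x * x)))) e)
    where
    triple : ∀ w → (1ℤ + 1ℤ + 1ℤ) * w ≡ w + w + w
    triple w = solve (w ∷ [])

  -- Each correction is a multiple of `p`, so the approximation stays a unit and `3ay²` remains
  -- invertible at the next step.
  hensel : ∀ {a} → Unit a → ∀ k {D x} → Unit x → a * (x * x * x) + D ≋ 0ℤ →
           ∃[ y ] Unit y × + (p ℕ.^ suc k) Signed.∣ a * (y * y * y) + D
  hensel a-unit zero {x = x} x-unit e =
    x , x-unit , subst (λ q → + q Signed.∣ _) (sym (ℕ.*-identityʳ p)) (≋0⇒∣ e)
  hensel {a} a-unit (suc k) {D} {x} x-unit e = lift (hensel a-unit k x-unit e)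
    where
    lift : ∃[ y ] Unit y × + (p ℕ.^ suc k) Signed.∣ a * (y * y * y) + D →
           ∃[ y ] Unit y × + (p ℕ.^ suc (suc k)) Signed.∣ a * (y * y * y) + D
    lift (y , y-unit , divides m f) =
      case inverse (derivative-unit a-unit y-unit) of λ where
        (v , mod (divides t g)) → lifted m v ,
          (λ y′≋0 → y-unit (≋-trans (unchanged y (- (m * v)) (p ℕ.^ k)) y′≋0)) ,
          subst (Signed._∣ (a * (lifted m v * lifted m v * lifted m v) + D))
            (sym (trans (+p^suc (suc k)) (cong (+ p *_) (+p^suc k))))
            (newton {a} {y} {D} {m} {v} {t} (+ p) (+ (p ℕ.^ k)) (trans f (cong (m *_) (+p^suc k))) g)
      where
      lifted : ℤ → ℤ → ℤ
      lifted m v = y + - (m * v) * (+ p * + (p ℕ.^ k))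
      unchanged : ∀ y s Q → y ≋ y + s * (+ p * + Q)
      unchanged y s Q = mod (divides (- (s * + Q)) (difference y s (+ Q) (+ p)))
        where
        difference : ∀ y s Q π → y - (y + s * (π * Q)) ≡ - (s * Q) * π
        difference y s Q π = solve (y ∷ s ∷ Q ∷ π ∷ [])

  -- As `p` divides `n`, a zero of the cubic modulo `p` is also one of the cubic minus `n`. It is
  -- lifted in a unit coordinate, with the other two held fixed inside the constant term.
  approximate : ∀ {a b c} → Unit a → Unit b → Unit c → ∀ k {n} → n ≋ 0ℤ →
                ∃[ v ] + (p ℕ.^ suc k) Signed.∣ diagonalCubic a b c v - n
  approximate {a} {b} {c} a-unit b-unit c-unit k {n} n≋0 = case solvable p≢3 a-unit b-unit c-unit of λ where
      (i , j , l , e , inj₁ i-unit) → from-x ⟦ i ⟧ ⟦ j ⟧ ⟦ l ⟧ i-unit e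
      (i , j , l , e , inj₂ (inj₁ j-unit)) → from-y ⟦ i ⟧ ⟦ j ⟧ ⟦ l ⟧ j-unit e
      (i , j , l , e , inj₂ (inj₂ l-unit)) → from-z ⟦ i ⟧ ⟦ j ⟧ ⟦ l ⟧ l-unit e
    where
    Approximation : Set
    Approximation = ∃[ v ] + (p ℕ.^ suc k) Signed.∣ diagonalCubic a b c v - n

    with-error : ∀ {x y z} w → w + n ≡ diagonalCubic a b c (x Vec.∷ y Vec.∷ z Vec.∷ Vec.[]) →
                 + (p ℕ.^ suc k) Signed.∣ w → Approximation
    with-error {x} {y} {z} w e d = (x Vec.∷ y Vec.∷ z Vec.∷ Vec.[]) ,
        subst (_ Signed.∣_) (trans (remove w n) (cong (_- n) e)) d
      where
      remove : ∀ w n → w ≡ w + n - n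
      remove w n = solve (w ∷ n ∷ [])

    from-x : ∀ x y z → Unit x → Zero a b c x y z → Approximation
    from-x x y z x-unit e =
      case hensel a-unit k x-unit (shift (b * (y * y * y)) (c * (z * z * z)) e) of λ where
        (x′ , _ , d) → with-error {x′} {y} {z} _ (evaluate x′) d
      where
      shift : ∀ Y Z → a * (x * x * x) + Y + Z ≋ 0ℤ → a * (x * x * x) + (Y + Z - n) ≋ 0ℤ
      shift Y Z e = by₂ 1ℤ (- 1ℤ) e n≋0 (rearrange (a * (x * x * x)))
        where
        rearrange : ∀ X → X + (Y + Z - n) - 0ℤ ≡ 1ℤ * (X + Y + Z - 0ℤ) + - 1ℤ * (n - 0ℤ)
        rearrange X = solve (X ∷ Y ∷ Z ∷ n ∷ [])
      -- The right-hand side is what the powers in `diagonalCubic` unfold to.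
      evaluate : ∀ x → a * (x * x * x) + (b * (y * y * y) + c * (z * z * z) - n) + n ≡
        a * (x * (x * (x * 1ℤ))) + b * (y * (y * (y * 1ℤ))) + c * (z * (z * (z * 1ℤ)))
      evaluate x = solve (a ∷ b ∷ c ∷ x ∷ y ∷ z ∷ n ∷ [])

    from-y : ∀ x y z → Unit y → Zero a b c x y z → Approximation
    from-y x y z y-unit e =
      case hensel b-unit k y-unit (shift (a * (x * x * x)) (c * (z * z * z)) e) of λ where
        (y′ , _ , d) → with-error {x} {y′} {z} _ (evaluate y′) d
      where
      shift : ∀ X Z → X + b * (y * y * y) + Z ≋ 0ℤ → b * (y * y * y) + (X + Z - n) ≋ 0ℤ
      shift X Z e = by₂ 1ℤ (- 1ℤ) e n≋0 (rearrange (b * (y * y * y)))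
        where
        rearrange : ∀ Y → Y + (X + Z - n) - 0ℤ ≡ 1ℤ * (X + Y + Z - 0ℤ) + - 1ℤ * (n - 0ℤ)
        rearrange Y = solve (X ∷ Y ∷ Z ∷ n ∷ [])
      evaluate : ∀ y → b * (y * y * y) + (a * (x * x * x) + c * (z * z * z) - n) + n ≡
        a * (x * (x * (x * 1ℤ))) + b * (y * (y * (y * 1ℤ))) + c * (z * (z * (z * 1ℤ)))
      evaluate y = solve (a ∷ b ∷ c ∷ x ∷ y ∷ z ∷ n ∷ [])

    from-z : ∀ x y z → Unit z → Zero a b c x y z → Approximation
    from-z x y z z-unit e =
      case hensel c-unit k z-unit (shift (a * (x * x * x)) (b * (y * y * y)) e) of λ where
        (z′ , _ , d) → with-error {x} {y} {z′} _ (evaluate z′) d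
      where
      shift : ∀ X Y → X + Y + c * (z * z * z) ≋ 0ℤ → c * (z * z * z) + (X + Y - n) ≋ 0ℤ
      shift X Y e = by₂ 1ℤ (- 1ℤ) e n≋0 (rearrange (c * (z * z * z)))
        where
        rearrange : ∀ Z → Z + (X + Y - n) - 0ℤ ≡ 1ℤ * (X + Y + Z - 0ℤ) + - 1ℤ * (n - 0ℤ)
        rearrange Z = solve (X ∷ Y ∷ Z ∷ n ∷ [])
      evaluate : ∀ z → c * (z * z * z) + (a * (x * x * x) + b * (y * y * y) - n) + n ≡
        a * (x * (x * (x * 1ℤ))) + b * (y * (y * (y * 1ℤ))) + c * (z * (z * (z * 1ℤ)))
      evaluate z = solve (a ∷ b ∷ c ∷ x ∷ y ∷ z ∷ n ∷ [])

-- Rationals as fractions not in lowest terms, and their comparison with `ε`.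

Represents : ℚ → ℤ → ℤ → Set
Represents q i j = ↥ q * j ≡ i * ↧ q

-- Addition in `ℚ` cancels common factors, so the schoolbook formula holds only after
-- cross-multiplication; it is imported from unnormalised rationals.
+-represents : ∀ x y → Represents (x ℚ.+ y) (↥ x * ↧ y + ↥ y * ↧ x) (↧ x * ↧ y)
+-represents x@record{} y@record{} = begin
  ↥ (x ℚ.+ y) * (↧ x * ↧ y)                     ≡⟨ cong (_* (↧ x * ↧ y)) (ℚ.↥ᵘ-toℚᵘ (x ℚ.+ y)) ⟨
  ℚᵘ.↥ (toℚᵘ (x ℚ.+ y)) * (↧ x * ↧ y)           ≡⟨ ℚᵘ.drop-*≡* (ℚ.toℚᵘ-homo-+ x y) ⟩
  (↥ x * ↧ y + ↥ y * ↧ x) * ℚᵘ.↧ (toℚᵘ (x ℚ.+ y)) ≡⟨ cong ((↥ x * ↧ y + ↥ y * ↧ x) *_) (ℚ.↧ᵘ-toℚᵘ (x ℚ.+ y)) ⟩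
  (↥ x * ↧ y + ↥ y * ↧ x) * ↧ (x ℚ.+ y)         ∎
  where open ≡-Reasoning

*-represents : ∀ x y → Represents (x ℚ.* y) (↥ x * ↥ y) (↧ x * ↧ y)
*-represents x@record{} y@record{} = begin
  ↥ (x ℚ.* y) * (↧ x * ↧ y)           ≡⟨ cong (_* (↧ x * ↧ y)) (ℚ.↥ᵘ-toℚᵘ (x ℚ.* y)) ⟨
  ℚᵘ.↥ (toℚᵘ (x ℚ.* y)) * (↧ x * ↧ y) ≡⟨ ℚᵘ.drop-*≡* (ℚ.toℚᵘ-homo-* x y) ⟩
  (↥ x * ↥ y) * ℚᵘ.↧ (toℚᵘ (x ℚ.* y)) ≡⟨ cong ((↥ x * ↥ y) *_) (ℚ.↧ᵘ-toℚᵘ (x ℚ.* y)) ⟩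
  (↥ x * ↥ y) * ↧ (x ℚ.* y)           ∎
  where open ≡-Reasoning

/1-represents : ∀ i → Represents (i ℚ./ 1) i 1ℤ
/1-represents i = begin
  ↥ (i ℚ./ 1) * 1ℤ            ≡⟨ cong (_* 1ℤ) (ℚ.↥ᵘ-toℚᵘ (i ℚ./ 1)) ⟨
  ℚᵘ.↥ (toℚᵘ (i ℚ./ 1)) * 1ℤ  ≡⟨ ℚᵘ.drop-*≡* (ℚ.toℚᵘ-fromℚᵘ (ℚᵘ.mkℚᵘ i 0)) ⟩
  i * ℚᵘ.↧ (toℚᵘ (i ℚ./ 1))   ≡⟨ cong (i *_) (ℚ.↧ᵘ-toℚᵘ (i ℚ./ 1)) ⟩
  i * ↧ (i ℚ./ 1)             ∎
  where open ≡-Reasoning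

neg-represents : ∀ q {i j} → Represents q i j → Represents (ℚ.- q) (- i) j
neg-represents q {i} {j} e = begin
  ↥ (ℚ.- q) * j   ≡⟨ cong (_* j) (ℚ.↥-neg q) ⟩
  - ↥ q * j       ≡⟨ ℤ.neg-distribˡ-* (↥ q) j ⟨
  - (↥ q * j)     ≡⟨ cong -_ e ⟩
  - (i * ↧ q)     ≡⟨ ℤ.neg-distribˡ-* i (↧ q) ⟩
  - i * ↧ q       ≡⟨ cong (- i *_) (ℚ.↧-neg q) ⟨
  - i * ↧ (ℚ.- q) ∎
  where open ≡-Reasoning

-- `β` is pinned down by `β · (j / 1) = i / 1`, which spares computing the reciprocal in lowest
-- terms; the denominators of `i / 1` and `j / 1` are then cancelled.
fraction-represents : ∀ i j j≢0 → Represents (fraction i j j≢0) i j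
fraction-represents i j j≢0 = sym (cancel (↥ (i ℚ./ 1)) (↧ (i ℚ./ 1)) (↥ (j ℚ./ 1)) (↧ (j ℚ./ 1))
    (/1-represents i) (/1-represents j)
    (trans (cong (_* (↧ β * ↧ (j ℚ./ 1))) (cong ↥_ (sym β*j≡i)))
      (trans (*-represents β (j ℚ./ 1)) (cong ((↥ β * ↥ (j ℚ./ 1)) *_) (cong ↧_ β*j≡i)))))
  where
  β = fraction i j j≢0
  instance
    j/1≢0 : ℚ.NonZero (j ℚ./ 1)
    j/1≢0 = /1-nonZero j≢0
  β*j≡i : β ℚ.* (j ℚ./ 1) ≡ i ℚ./ 1
  β*j≡i = begin
    (i ℚ./ 1) ℚ.* (ℚ.1/ (j ℚ./ 1)) ℚ.* (j ℚ./ 1)   ≡⟨ ℚ.*-assoc (i ℚ./ 1) _ _ ⟩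
    (i ℚ./ 1) ℚ.* (ℚ.1/ (j ℚ./ 1) ℚ.* (j ℚ./ 1))   ≡⟨ cong ((i ℚ./ 1) ℚ.*_) (ℚ.*-inverseˡ (j ℚ./ 1)) ⟩
    (i ℚ./ 1) ℚ.* ℚ.1ℚ                             ≡⟨ ℚ.*-identityʳ (i ℚ./ 1) ⟩
    i ℚ./ 1                                        ∎
    where open ≡-Reasoning
  cancel : ∀ I I′ J J′ .{{_ : NonZero I′}} .{{_ : NonZero J′}} → I * 1ℤ ≡ i * I′ → J * 1ℤ ≡ j * J′ →
           I * (↧ β * J′) ≡ (↥ β * J) * I′ → i * ↧ β ≡ ↥ β * j
  cancel I I′ J J′ f g h = ℤ.*-cancelʳ-≡ _ _ (I′ * J′) {{ℤ.i*j≢0 I′ J′}} (begin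
    i * ↧ β * (I′ * J′)       ≡⟨ left i I′ J′ (↧ β) ⟩
    i * I′ * (↧ β * J′)       ≡⟨ cong (_* (↧ β * J′)) (trans (sym f) (ℤ.*-identityʳ I)) ⟩
    I * (↧ β * J′)            ≡⟨ h ⟩
    ↥ β * J * I′              ≡⟨ cong (λ K → ↥ β * K * I′) (trans (sym (ℤ.*-identityʳ J)) g) ⟩
    ↥ β * (j * J′) * I′       ≡⟨ right (↥ β) j J′ I′ ⟩
    ↥ β * j * (I′ * J′)       ∎)
    where
    open ≡-Reasoning
    left : ∀ i I′ J′ B → i * B * (I′ * J′) ≡ i * I′ * (B * J′)
    left i I′ J′ B = solve (i ∷ I′ ∷ J′ ∷ B ∷ [])
    right : ∀ A j J′ I′ → A * (j * J′) * I′ ≡ A * j * (I′ * J′)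
    right A j J′ I′ = solve (A ∷ j ∷ J′ ∷ I′ ∷ [])

-fraction-represents : ∀ q i j j≢0 → Represents (q ℚ.- fraction i j j≢0) (↥ q * j - i * ↧ q) (↧ q * j)
-fraction-represents q i j j≢0 =
    cancel (↧ z) (↥ (ℚ.- β)) (↧ (ℚ.- β)) (neg-represents β {i} {j} (fraction-represents i j j≢0))
      (+-represents q (ℚ.- β))
  where
  β = fraction i j j≢0
  z = q ℚ.- β
  cancel : ∀ Z A B .{{_ : NonZero B}} → A * j ≡ - i * B → ↥ z * (↧ q * B) ≡ (↥ q * B + A * ↧ q) * Z →
           ↥ z * (↧ q * j) ≡ (↥ q * j - i * ↧ q) * Z
  cancel Z A B f g = ℤ.*-cancelʳ-≡ _ _ B (begin
    ↥ z * (↧ q * j) * B                  ≡⟨ left (↥ z) (↧ q) j B ⟩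
    ↥ z * (↧ q * B) * j                  ≡⟨ cong (_* j) g ⟩
    (↥ q * B + A * ↧ q) * Z * j          ≡⟨ middle (↥ q) B A (↧ q) Z j ⟩
    (↥ q * B * j + A * j * ↧ q) * Z      ≡⟨ cong (λ K → (↥ q * B * j + K * ↧ q) * Z) f ⟩
    (↥ q * B * j + - i * B * ↧ q) * Z    ≡⟨ right (↥ q) B i (↧ q) Z j ⟩
    (↥ q * j - i * ↧ q) * Z * B          ∎)
    where
    open ≡-Reasoning
    left : ∀ Y d j B → Y * (d * j) * B ≡ Y * (d * B) * j
    left Y d j B = solve (Y ∷ d ∷ j ∷ B ∷ [])
    middle : ∀ m B A d Z j → (m * B + A * d) * Z * j ≡ (m * B * j + A * j * d) * Z
    middle m B A d Z j = solve (m ∷ B ∷ A ∷ d ∷ Z ∷ j ∷ [])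
    right : ∀ m B i d Z j → (m * B * j + - i * B * d) * Z ≡ (m * j - i * d) * Z * B
    right m B i d Z j = solve (m ∷ B ∷ i ∷ d ∷ Z ∷ j ∷ [])

positive-numerator : ∀ {ε} → 0ℚ ℚ.< ε → ∃[ E ] ↥ ε ≡ + suc E
positive-numerator {mkℚ +[1+ n ] _ _} _ = n , refl
positive-numerator {mkℚ +0 _ _}       h = case ℚ.positive h of λ ()
positive-numerator {mkℚ -[1+ _ ] _ _} h = case ℚ.positive h of λ ()

module _ {ε E} (↥ε≡E : ↥ ε ≡ + E) where

  private
    cross : ∀ m n .{{_ : ℕ.NonZero n}} →
            + m * ℚᵘ.↧ (toℚᵘ ε) ≡ + (m ℕ.* ↧ₙ ε) × ℚᵘ.↥ (toℚᵘ ε) * + n ≡ + (E ℕ.* n)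
    cross m n = trans (cong (+ m *_) (ℚ.↧ᵘ-toℚᵘ ε)) (sym (ℤ.pos-* m (↧ₙ ε))) ,
                trans (cong (_* + n) (trans (ℚ.↥ᵘ-toℚᵘ ε) ↥ε≡E)) (sym (ℤ.pos-* E n))

    toℚᵘ-/ : ∀ m n → toℚᵘ (+ m ℚ./ suc n) ℚᵘ.≃ ℚᵘ.mkℚᵘ (+ m) n
    toℚᵘ-/ m n = ℚ.toℚᵘ-fromℚᵘ (ℚᵘ.mkℚᵘ (+ m) n)

  /<⇒*<* : ∀ m n .{{_ : ℕ.NonZero n}} → + m ℚ./ n ℚ.< ε → m ℕ.* ↧ₙ ε ℕ.< E ℕ.* n
  /<⇒*<* m (suc n) h = ℤ.drop‿+<+ (subst₂ _<_ (proj₁ (cross m (suc n))) (proj₂ (cross m (suc n)))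
    (ℚᵘ.drop-*<* (ℚᵘ.<-respˡ-≃ (toℚᵘ-/ m n) (ℚ.toℚᵘ-mono-< h))))

  *<*⇒/< : ∀ m n .{{_ : ℕ.NonZero n}} → m ℕ.* ↧ₙ ε ℕ.< E ℕ.* n → + m ℚ./ n ℚ.< ε
  *<*⇒/< m (suc n) h = ℚ.toℚᵘ-cancel-< (ℚᵘ.<-respˡ-≃ (ℚᵘ.≃-sym (toℚᵘ-/ m n)) (ℚᵘ.*<*
    (subst₂ _<_ (sym (proj₁ (cross m (suc n)))) (sym (proj₂ (cross m (suc n)))) (+<+ h))))

-- Cross-multiplied: the bound `E/f` passes between the equal fractions `A/B` and `C/D`.
*-transfer-< : ∀ {A B C D E f} .{{_ : ℕ.NonZero A}} .{{_ : ℕ.NonZero C}} → B ℕ.* C ≡ D ℕ.* A →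
               A ℕ.* f ℕ.< E ℕ.* B → C ℕ.* f ℕ.< E ℕ.* D
*-transfer-< {A} {B} {C} {D} {E} {f} BC≡DA h = ℕ.*-cancelʳ-< A _ _ (begin-strict
  C ℕ.* f ℕ.* A     ≡⟨ rotate C f A ⟩
  A ℕ.* f ℕ.* C     <⟨ ℕ.*-monoˡ-< C h ⟩
  E ℕ.* B ℕ.* C     ≡⟨ ℕ.*-assoc E B C ⟩
  E ℕ.* (B ℕ.* C)   ≡⟨ cong (E ℕ.*_) BC≡DA ⟩
  E ℕ.* (D ℕ.* A)   ≡⟨ ℕ.*-assoc E D A ⟨
  E ℕ.* D ℕ.* A     ∎)
  where
  open ℕ.≤-Reasoning
  rotate : ∀ C f A → C ℕ.* f ℕ.* A ≡ A ℕ.* f ℕ.* C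
  rotate C f A = ℕSolver.solve (C ∷ f ∷ A ∷ [])

-- The `p`-adic valuation.

module Valuation (p : ℕ) (p-prime : Prime p) where

  private instance
    p≢0 : ℕ.NonZero p
    p≢0 = prime⇒nonZero p-prime

  p^≢0 : ∀ k → ℕ.NonZero (p ℕ.^ k)
  p^≢0 k = ℕ.m^n≢0 p k

  1<p : 1 ℕ.< p
  1<p = ℕ.nonTrivial⇒n>1 p {{prime⇒nonTrivial p-prime}}

  n<p^n : ∀ n → n ℕ.< p ℕ.^ n
  n<p^n zero    = ℕ.≤-refl
  n<p^n (suc n) = ℕ.≤-<-trans (n<p^n n)
    (ℕ.<-≤-trans (ℕ.m<m*n (p ℕ.^ n) p {{p^≢0 n}} 1<p) (ℕ.≤-reflexive (ℕ.*-comm (p ℕ.^ n) p)))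

  p^-mono-∣ : ∀ {j k} → j ℕ.≤ k → p ℕ.^ j ℕ.∣ p ℕ.^ k
  p^-mono-∣ {j} {k} j≤k = ℕ.divides (p ℕ.^ (k ℕ.∸ j))
    (trans (cong (p ℕ.^_) (sym (ℕ.m∸n+n≡m j≤k))) (ℕ.^-distribˡ-+-* p (k ℕ.∸ j) j))

  -- Division by `p` makes `n` strictly smaller, so the fuel cannot run out while the quotient is
  -- nonzero.
  ordWithin-decomposes : ∀ fuel n .{{_ : ℕ.NonZero n}} → n ℕ.≤ fuel →
                         ∃[ u ] n ≡ p ℕ.^ ordWithin p p-prime fuel n ℕ.* u × ¬ p ℕ.∣ u
  ordWithin-decomposes zero (suc n) ()
  ordWithin-decomposes (suc fuel) n n≤fuel with p ℕ.∣? n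
  ... | no p∤n = n , sym (ℕ.*-identityˡ n) , p∤n
  ... | yes p∣n = Product.map₂ (Product.map₁ scaled) (ordWithin-decomposes fuel (n ℕ./ p) {{n/p≢0}} n/p≤fuel)
    where
    n/p≤fuel : n ℕ./ p ℕ.≤ fuel
    n/p≤fuel = ℕ.s≤s⁻¹ (ℕ.<-≤-trans (ℕ.m/n<m n p 1<p) n≤fuel)
    n/p≢0 : ℕ.NonZero (n ℕ./ p)
    n/p≢0 = ℕ.m*n≢0⇒m≢0 (n ℕ./ p) {p} {{subst ℕ.NonZero (sym (ℕ.m/n*n≡m p∣n)) it}}
    scaled : ∀ {q u} → n ℕ./ p ≡ q ℕ.* u → n ≡ p ℕ.* q ℕ.* u
    scaled {q} {u} e = trans (sym (ℕ.m/n*n≡m p∣n)) (trans (cong (ℕ._* p) e) (rotate p q u))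
      where
      rotate : ∀ p q u → q ℕ.* u ℕ.* p ≡ p ℕ.* q ℕ.* u
      rotate p q u = ℕSolver.solve (p ∷ q ∷ u ∷ [])

  -- If `k < j`, cancelling `p ^ k` from `p ^ suc k` would leave `p` dividing `u`.
  ∣-exponent : ∀ {j k u} → p ℕ.^ j ℕ.∣ p ℕ.^ k ℕ.* u → ¬ p ℕ.∣ u → j ℕ.≤ k
  ∣-exponent {j} {k} {u} d p∤u = ℕ.≮⇒≥ λ k<j → p∤u (ℕ.*-cancelˡ-∣ (p ℕ.^ k) {{p^≢0 k}}
    (subst (ℕ._∣ p ℕ.^ k ℕ.* u) (ℕ.*-comm p (p ℕ.^ k)) (ℕ.∣-trans (p^-mono-∣ k<j) d)))

  ν : ℕ → ℕ
  ν = ord p p-prime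

  ν-decomposes : ∀ n .{{_ : ℕ.NonZero n}} → ∃[ u ] n ≡ p ℕ.^ ν n ℕ.* u × ¬ p ℕ.∣ u
  ν-decomposes n = ordWithin-decomposes n n ℕ.≤-refl

  p^ν∣ : ∀ n .{{_ : ℕ.NonZero n}} → p ℕ.^ ν n ℕ.∣ n
  p^ν∣ n = case ν-decomposes n of λ where
    (u , e , _) → ℕ.divides u (trans e (ℕ.*-comm (p ℕ.^ ν n) u))

  p^∣⇒≤ν : ∀ {k} n .{{_ : ℕ.NonZero n}} → p ℕ.^ k ℕ.∣ n → k ℕ.≤ ν n
  p^∣⇒≤ν {k} n d = case ν-decomposes n of λ where
    (u , e , p∤u) → ∣-exponent {k} {ν n} {u} (subst (p ℕ.^ k ℕ.∣_) e d) p∤u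

  p^∤⇒ν≤ : ∀ {k} n .{{_ : ℕ.NonZero n}} → ¬ p ℕ.^ suc k ℕ.∣ n → ν n ℕ.≤ k
  p^∤⇒ν≤ {k} n ∤n = ℕ.≮⇒≥ λ k<ν → ∤n (ℕ.∣-trans (p^-mono-∣ k<ν) (p^ν∣ n))

  -- By Euclid's lemma the product of the cofactors is prime to `p`, which bounds the valuation
  -- above; multiplying the two divisibilities bounds it below.
  ν-* : ∀ m n .{{_ : ℕ.NonZero m}} .{{_ : ℕ.NonZero n}} → ν (m ℕ.* n) ≡ ν m ℕ.+ ν n
  ν-* m n = case ν-decomposes m of λ where
      (u , e , p∤u) → case ν-decomposes n of λ where
        (w , f , p∤w) → ℕ.≤-antisym
          (∣-exponent {ν (m ℕ.* n)}
            (subst (p ℕ.^ ν (m ℕ.* n) ℕ.∣_) (factored e f) (p^ν∣ (m ℕ.* n) {{ℕ.m*n≢0 m n}}))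
            (Sum.[ p∤u , p∤w ] ∘ euclidsLemma u w p-prime))
          (p^∣⇒≤ν (m ℕ.* n) {{ℕ.m*n≢0 m n}} (subst (ℕ._∣ m ℕ.* n) (sym (ℕ.^-distribˡ-+-* p (ν m) (ν n)))
            (ℕ.*-pres-∣ (p^ν∣ m) (p^ν∣ n))))
    where
    factored : ∀ {u w} → m ≡ p ℕ.^ ν m ℕ.* u → n ≡ p ℕ.^ ν n ℕ.* w →
               m ℕ.* n ≡ p ℕ.^ (ν m ℕ.+ ν n) ℕ.* (u ℕ.* w)
    factored {u} {w} e f = trans (cong₂ ℕ._*_ e f) (trans (interchange (p ℕ.^ ν m) (p ℕ.^ ν n) u w)
      (cong (ℕ._* (u ℕ.* w)) (sym (ℕ.^-distribˡ-+-* p (ν m) (ν n)))))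
      where
      interchange : ∀ P Q u w → P ℕ.* u ℕ.* (Q ℕ.* w) ≡ P ℕ.* Q ℕ.* (u ℕ.* w)
      interchange P Q u w = ℕSolver.solve (P ∷ Q ∷ u ∷ w ∷ [])

  p^ν-* : ∀ m n .{{_ : ℕ.NonZero m}} .{{_ : ℕ.NonZero n}} → p ℕ.^ ν (m ℕ.* n) ≡ p ℕ.^ ν m ℕ.* p ℕ.^ ν n
  p^ν-* m n = trans (cong (p ℕ.^_) (ν-* m n)) (ℕ.^-distribˡ-+-* p (ν m) (ν n))

  ∣_∣ₚ : ℚ → ℚ
  ∣_∣ₚ = abs p p-prime

  abs-0 : ∀ {q} → q ≡ 0ℚ → ∣ q ∣ₚ ≡ 0ℚ
  abs-0 {q} q≡0 with q ℚ.≟ 0ℚ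
  ... | yes _   = refl
  ... | no q≢0 = ⊥-elim (q≢0 q≡0)

  abs-≢0 : ∀ {q} → q ≢ 0ℚ → ∣ q ∣ₚ ≡ ℚ._/_ (+ (p ℕ.^ ν (↧ₙ q))) (p ℕ.^ ν ∣ ↥ q ∣) {{p^≢0 (ν ∣ ↥ q ∣)}}
  abs-≢0 {q} q≢0 with q ℚ.≟ 0ℚ
  ... | yes q≡0 = ⊥-elim (q≢0 q≡0)
  ... | no _    = refl

-- Balls and the strong triangle inequality.

module Balls (p : ℕ) (p-prime : Prime p) {ε E} (0<ε : 0ℚ ℚ.< ε) (↥ε≡E : ↥ ε ≡ + suc E) where
  open Valuation p p-prime

  -- For j ≢ 0 this says |i/j|ₚ < ε; quantifying over k avoids the junk valuation of i = 0.
  Small : ℤ → ℤ → Set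
  Small i j = ∃[ k ] + (p ℕ.^ k) Signed.∣ i × p ℕ.^ ν ∣ j ∣ ℕ.* ↧ₙ ε ℕ.< suc E ℕ.* p ℕ.^ k

  private
    module _ {q i j} .{{_ : NonZero j}} (e : Represents q i j) (q≢0 : q ≢ 0ℚ) where
      ∣↥q∣≢0 : ℕ.NonZero ∣ ↥ q ∣
      ∣↥q∣≢0 = ℕ.≢-nonZero (q≢0 ∘ ℚ.↥p≡0⇒p≡0 q ∘ ℤ.∣i∣≡0⇒i≡0)

      equality : ∣ ↥ q ∣ ℕ.* ∣ j ∣ ≡ ∣ i ∣ ℕ.* ↧ₙ q
      equality = trans (sym (ℤ.abs-* (↥ q) j)) (trans (cong ∣_∣ e) (ℤ.abs-* i (↧ q)))

      ∣i∣≢0 : ℕ.NonZero ∣ i ∣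
      ∣i∣≢0 = ℕ.m*n≢0⇒m≢0 ∣ i ∣ {↧ₙ q} {{subst ℕ.NonZero equality (ℕ.m*n≢0 ∣ ↥ q ∣ ∣ j ∣ {{∣↥q∣≢0}})}}

      p^ν-equality : p ℕ.^ ν ∣ ↥ q ∣ ℕ.* p ℕ.^ ν ∣ j ∣ ≡ p ℕ.^ ν ∣ i ∣ ℕ.* p ℕ.^ ν (↧ₙ q)
      p^ν-equality = trans (sym (p^ν-* ∣ ↥ q ∣ ∣ j ∣ {{∣↥q∣≢0}}))
        (trans (cong (λ n → p ℕ.^ ν n) equality) (p^ν-* ∣ i ∣ (↧ₙ q) {{∣i∣≢0}}))

    zero-numerator : ∀ {q i j} → Represents q i j → q ≡ 0ℚ → i ≡ 0ℤ
    zero-numerator {q} {i} {j} e q≡0 =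
      case ℤ.i*j≡0⇒i≡0∨j≡0 i {↧ q} (trans (sym e) (cong (_* j) (ℚ.p≡0⇒↥p≡0 q q≡0))) of λ where
        (inj₁ i≡0) → i≡0

  -- For `q ≢ 0ℚ`, taking valuations in `↥ q * j ≡ i * ↧ q` shows that any representing fraction
  -- computes the absolute value.
  abs<⇒small : ∀ q i j .{{_ : NonZero j}} → Represents q i j → ∣ q ∣ₚ ℚ.< ε → Small i j
  abs<⇒small q i j e h = case q ℚ.≟ 0ℚ of λ where
    -- Every power of `p` divides `i = 0`. Taking the quantity to be bounded as the exponent
    -- suffices, by `n < p ^ n`.
    (yes q≡0) → p ℕ.^ ν ∣ j ∣ ℕ.* ↧ₙ ε , divides 0ℤ (zero-numerator {q} {i} {j} e q≡0) ,
      ℕ.<-≤-trans (n<p^n (p ℕ.^ ν ∣ j ∣ ℕ.* ↧ₙ ε)) (ℕ.m≤m+n _ _)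
    (no q≢0) → ν ∣ i ∣ , ∣ᵤ⇒∣ (p^ν∣ ∣ i ∣ {{∣i∣≢0 {q} {i} {j} e q≢0}}) ,
      *-transfer-< {p ℕ.^ ν (↧ₙ q)} {p ℕ.^ ν ∣ ↥ q ∣} {p ℕ.^ ν ∣ j ∣} {p ℕ.^ ν ∣ i ∣} {suc E} {↧ₙ ε}
        {{p^≢0 (ν (↧ₙ q))}} {{p^≢0 (ν ∣ j ∣)}} (p^ν-equality {q} {i} {j} e q≢0)
        (/<⇒*<* ↥ε≡E (p ℕ.^ ν (↧ₙ q)) (p ℕ.^ ν ∣ ↥ q ∣) {{p^≢0 (ν ∣ ↥ q ∣)}} (subst (ℚ._< ε) (abs-≢0 q≢0) h))

  small⇒abs< : ∀ q i j .{{_ : NonZero j}} → Represents q i j → Small i j → ∣ q ∣ₚ ℚ.< ε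
  small⇒abs< q i j e (k , p^k∣i , h) = case q ℚ.≟ 0ℚ of λ where
    (yes q≡0) → subst (ℚ._< ε) (sym (abs-0 q≡0)) 0<ε
    (no q≢0) → subst (ℚ._< ε) (sym (abs-≢0 q≢0))
      (*<*⇒/< ↥ε≡E (p ℕ.^ ν (↧ₙ q)) (p ℕ.^ ν ∣ ↥ q ∣) {{p^≢0 (ν ∣ ↥ q ∣)}}
      (*-transfer-< {p ℕ.^ ν ∣ j ∣} {p ℕ.^ ν ∣ i ∣} {p ℕ.^ ν (↧ₙ q)} {p ℕ.^ ν ∣ ↥ q ∣} {suc E} {↧ₙ ε}
        {{p^≢0 (ν ∣ j ∣)}} {{p^≢0 (ν (↧ₙ q))}} (sym (p^ν-equality {q} {i} {j} e q≢0))
        (ℕ.<-≤-trans h (ℕ.*-monoʳ-≤ (suc E) (ℕ.^-monoʳ-≤ p {{prime⇒nonZero p-prime}}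
          (p^∣⇒≤ν {k} ∣ i ∣ {{∣i∣≢0 {q} {i} {j} e q≢0}} (∣⇒∣ᵤ p^k∣i)))))))

  small-+ : ∀ {i i′ j} → Small i j → Small i′ j → Small (i + i′) j
  small-+ (k , d , h) (k′ , d′ , h′) = case ℕ.≤-total k k′ of λ where
      (inj₁ k≤k′) → k , Signed.∣m∣n⇒∣m+n d (Signed.∣-trans (lower k≤k′) d′) , h
      (inj₂ k′≤k) → k′ , Signed.∣m∣n⇒∣m+n (Signed.∣-trans (lower k′≤k) d) d′ , h′
    where
    lower : ∀ {k k′} → k ℕ.≤ k′ → + (p ℕ.^ k) Signed.∣ + (p ℕ.^ k′)
    lower k≤k′ = ∣ᵤ⇒∣ (p^-mono-∣ k≤k′)

  -- Over the common denominator `↧ x * ↧ y`, the smaller of the two powers of `p` divides both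
  -- numerators, hence their sum.
  ultrametric : ∀ x y → ∣ x ∣ₚ ℚ.< ε → ∣ y ∣ₚ ℚ.< ε → ∣ x ℚ.+ y ∣ₚ ℚ.< ε
  ultrametric x y hx hy = small⇒abs< (x ℚ.+ y) _ (↧ x * ↧ y) (+-represents x y) (small-+
      {↥ x * ↧ y} {↥ y * ↧ x} {↧ x * ↧ y}
      (abs<⇒small x (↥ x * ↧ y) (↧ x * ↧ y) (left (↥ x) (↧ x) (↧ y)) hx)
      (abs<⇒small y (↥ y * ↧ x) (↧ x * ↧ y) (right (↥ y) (↧ x) (↧ y)) hy))
    where
    left : ∀ m d d′ → m * (d * d′) ≡ m * d′ * d
    left m d d′ = solve (m ∷ d ∷ d′ ∷ [])
    right : ∀ m d d′ → m * (d * d′) ≡ m * d * d′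
    right m d d′ = solve (m ∷ d ∷ d′ ∷ [])

-- Density of the ratio set.

module Density (p : ℕ) (p-prime : Prime p) (p≢3 : p ≢ 3) (a b c : ℤ) (p∤abc : ¬ (+ p ∣ a * b * c)) where
  open Residues p p-prime
  open Hensel p p-prime p≢3
  open Valuation p p-prime

  private
    abc≢0 : a * b * c ≋ 0ℤ → ⊥
    abc≢0 e = p∤abc (∣⇒∣ᵤ (≋0⇒∣ e))

    a-unit : Unit a
    a-unit e = abc≢0 (by₁ (b * c) e (solve (a ∷ b ∷ c ∷ [])))

    b-unit : Unit b
    b-unit e = abc≢0 (by₁ (a * c) e (solve (a ∷ b ∷ c ∷ [])))

    c-unit : Unit c
    c-unit e = abc≢0 (by₁ (a * b) e (solve (a ∷ b ∷ c ∷ [])))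

    C : Vec ℤ 3 → ℤ
    C = diagonalCubic a b c

  -- The factor `p` brings an arbitrary `n` within reach of `approximate`; it cancels in ratios.
  multiple-approximated : ∀ k n → ∃[ v ] + (p ℕ.^ suc k) Signed.∣ C v - + p * n
  multiple-approximated k n = approximate a-unit b-unit c-unit k (∣⇒≋0 (Signed.∣m⇒∣m*n n Signed.∣-refl))

  -- Numerator and denominator of `(p * ↥ q) / (p * ↧ q)` are replaced by values of `C` congruent to
  -- them modulo `p ^ suc k`.
  ratio-near : ∀ q {ε} → 0ℚ ℚ.< ε → ∃[ x ] ∃[ y ] ∃[ Cy≢0 ] ∣ q ℚ.- fraction (C x) (C y) Cy≢0 ∣ₚ ℚ.< ε
  ratio-near q {ε} 0<ε =
    near (positive-numerator 0<ε) (multiple-approximated k (↥ q)) (multiple-approximated k (↧ q))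
    where
    d f o k : ℕ
    d = ↧ₙ q
    f = ↧ₙ ε
    o = ν d
    -- The valuation of d · C y is at most 2 ν d + 1, and ε ≥ 1 / f > p ^ (- f).
    k = o ℕ.+ o ℕ.+ f

    2+o≤1+k : suc (suc o) ℕ.≤ suc k
    -- This uses `f ≥ 1`, as `f` is a denominator.
    2+o≤1+k = ℕ.s≤s (ℕ.≤-trans (ℕ.≤-reflexive (ℕ.+-comm 1 o)) (ℕ.+-mono-≤ (ℕ.m≤m+n o o) (ℕ.s≤s ℕ.z≤n)))

    near : ∃[ E ] ↥ ε ≡ + suc E →
           ∃[ x ] + (p ℕ.^ suc k) Signed.∣ C x - + p * ↥ q →
           ∃[ y ] + (p ℕ.^ suc k) Signed.∣ C y - + p * ↧ q →
           ∃[ x ] ∃[ y ] ∃[ Cy≢0 ] ∣ q ℚ.- fraction (C x) (C y) Cy≢0 ∣ₚ ℚ.< ε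
    near (E , ↥ε≡E) (x , x-near) (y , y-near) = x , y , Cy≢0 ,
        Balls.small⇒abs< p p-prime 0<ε ↥ε≡E (q ℚ.- fraction (C x) (C y) Cy≢0)
          (↥ q * C y - C x * ↧ q) (↧ q * C y)
          {{ℤ.i*j≢0 (↧ q) (C y) {{_}} {{≢-nonZero Cy≢0}}}} (-fraction-represents q (C x) (C y) Cy≢0)
          (suc k , numerator-small , denominator-bound)
      where
      -- Otherwise `p ^ suc (suc o)` would divide `p * d` by `y-near`, and so `p ^ suc o` would
      -- divide `d`, against `o = ν d`. This both keeps `C y` nonzero and bounds its valuation.
      p^2+o∤Cy : ¬ + (p ℕ.^ suc (suc o)) Signed.∣ C y
      p^2+o∤Cy h = ℕ.1+n≰n (p^∣⇒≤ν {suc o} d (ℕ.*-cancelˡ-∣ p {{prime⇒nonZero p-prime}}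
        (subst (p ℕ.^ suc (suc o) ℕ.∣_) (ℤ.abs-* (+ p) (↧ q))
        (∣⇒∣ᵤ (subst (_ Signed.∣_) (remove (C y) (+ p * ↧ q))
          (Signed.∣m∣n⇒∣m-n h (Signed.∣-trans (∣ᵤ⇒∣ (p^-mono-∣ 2+o≤1+k)) y-near)))))))
        where
        remove : ∀ X Y → X - (X - Y) ≡ Y
        remove X Y = solve (X ∷ Y ∷ [])

      Cy≢0 : C y ≢ 0ℤ
      Cy≢0 Cy≡0 = p^2+o∤Cy (divides 0ℤ Cy≡0)

      numerator-small : + (p ℕ.^ suc k) Signed.∣ ↥ q * C y - C x * ↧ q
      -- The main terms `p * ↥ q * ↧ q` cancel.
      numerator-small = subst (_ Signed.∣_) (combine (↥ q) (↧ q) (C x) (C y) (+ p))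
        (Signed.∣m∣n⇒∣m-n (Signed.∣n⇒∣m*n (↥ q) y-near) (Signed.∣n⇒∣m*n (↧ q) x-near))
        where
        combine : ∀ m d X Y π → m * (Y - π * d) - d * (X - π * m) ≡ m * Y - X * d
        combine m d X Y π = solve (m ∷ d ∷ X ∷ Y ∷ π ∷ [])

      ν-denominator : ν ∣ ↧ q * C y ∣ ℕ.≤ suc (o ℕ.+ o)
      ν-denominator = begin
        ν ∣ ↧ q * C y ∣     ≡⟨ cong ν (ℤ.abs-* (↧ q) (C y)) ⟩
        ν (d ℕ.* ∣ C y ∣)   ≡⟨ ν-* d ∣ C y ∣ {{_}} {{≢-nonZero Cy≢0}} ⟩
        o ℕ.+ ν ∣ C y ∣     ≤⟨ ℕ.+-monoʳ-≤ o (p^∤⇒ν≤ {suc o} ∣ C y ∣ {{≢-nonZero Cy≢0}} (p^2+o∤Cy ∘ ∣ᵤ⇒∣)) ⟩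
        o ℕ.+ suc o       ≡⟨ ℕ.+-suc o o ⟩
        suc (o ℕ.+ o)     ∎
        where open ℕ.≤-Reasoning

      denominator-bound : p ℕ.^ ν ∣ ↧ q * C y ∣ ℕ.* f ℕ.< suc E ℕ.* p ℕ.^ suc k
      denominator-bound = begin-strict
        p ℕ.^ ν ∣ ↧ q * C y ∣ ℕ.* f
          ≤⟨ ℕ.*-monoˡ-≤ f (ℕ.^-monoʳ-≤ p {{prime⇒nonZero p-prime}} ν-denominator) ⟩
        p ℕ.^ suc (o ℕ.+ o) ℕ.* f
          <⟨ ℕ.*-monoʳ-< (p ℕ.^ suc (o ℕ.+ o)) {{p^≢0 (suc (o ℕ.+ o))}} (n<p^n f) ⟩
        p ℕ.^ suc (o ℕ.+ o) ℕ.* p ℕ.^ f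
          ≡⟨ ℕ.^-distribˡ-+-* p (suc (o ℕ.+ o)) f ⟨
        p ℕ.^ suc k
          ≤⟨ ℕ.m≤m+n _ _ ⟩
        suc E ℕ.* p ℕ.^ suc k            ∎
        where open ℕ.≤-Reasoning

  -- From some index `N` on, the terms of `α` are within `ε` of its `N`-th term. By the strong
  -- triangle inequality it is enough to approximate that single rational, with the same `ε`.
  dense : Dense p p-prime (R p p-prime C)
  dense α ε 0<ε = approach (cauchy α ε 0<ε)
    where
    approach : ∃[ N ] (∀ m n → N ℕ.≤ m → N ℕ.≤ n → ∣ term α m ℚ.- term α n ∣ₚ ℚ.< ε) →
               ∃[ β ] (R p p-prime C β × Within p p-prime ε α β)
    approach (N , settled) = conclude (ratio-near (term α N) 0<ε) (positive-numerator 0<ε)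
      where
      conclude : ∃[ x ] ∃[ y ] ∃[ Cy≢0 ] ∣ term α N ℚ.- fraction (C x) (C y) Cy≢0 ∣ₚ ℚ.< ε →
                 ∃[ E ] ↥ ε ≡ + suc E →
                 ∃[ β ] (R p p-prime C β × Within p p-prime ε α β)
      conclude (x , y , Cy≢0 , close) (E , ↥ε≡E) = ι p p-prime β ,
          -- A constant sequence is equivalent to itself by its own Cauchy property, with index 0.
          (x , y , Cy≢0 , λ δ 0<δ → 0 , λ n _ → proj₂ (cauchy (ι p p-prime β) δ 0<δ) n n ℕ.z≤n ℕ.z≤n) ,
          N , λ n N≤n → subst (λ r → ∣ r ∣ₚ ℚ.< ε) (telescope (term α n) (term α N) β)
            (Balls.ultrametric p p-prime 0<ε ↥ε≡E (term α n ℚ.- term α N) (term α N ℚ.- β)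
              (settled n N N≤n ℕ.≤-refl) close)
        where
        β : ℚ
        β = fraction (C x) (C y) Cy≢0
        telescope : ∀ r s t → (r ℚ.- s) ℚ.+ (s ℚ.- t) ≡ r ℚ.- t
        telescope r s t = begin
          (r ℚ.- s) ℚ.+ (s ℚ.- t)          ≡⟨ ℚ.+-assoc r (ℚ.- s) (s ℚ.- t) ⟩
          r ℚ.+ (ℚ.- s ℚ.+ (s ℚ.- t))      ≡⟨ cong (r ℚ.+_) (ℚ.+-assoc (ℚ.- s) s (ℚ.- t)) ⟨
          r ℚ.+ (ℚ.- s ℚ.+ s ℚ.- t)        ≡⟨ cong (λ u → r ℚ.+ (u ℚ.- t)) (ℚ.+-inverseˡ s) ⟩
          r ℚ.+ (0ℚ ℚ.- t)                 ≡⟨ cong (r ℚ.+_) (ℚ.+-identityˡ (ℚ.- t)) ⟩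
          r ℚ.- t                          ∎
          where open ≡-Reasoning

theorem1p5 : (p : ℕ) (p-prime : Prime p) → p ≢ 3 →
    (a b c : ℤ) → ¬ (+ p ∣ a * b * c) →
    Dense p p-prime (R p p-prime (diagonalCubic a b c))
theorem1p5 p p-prime p≢3 a b c p∤abc = Density.dense p p-prime p≢3 a b c p∤abc
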